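{- For every positive integer $n$, (1) $$\sum_{\sigma\in S_n}q^{\ell_S(\sigma)}t^{\mathrm{del}_S(\sigma)}=\sum_{\sigma\in S_n}q^{\mathrm{rmaj}_{S_n}(\sigma)}t^{\mathrm{del}_S(\sigma)}=(1+qt)(1+q+q^2t)\cdots(1+q+\dots+q^{n-2}+q^{n-1}t),$$ (2) $$\sum_{w\in A_{n+1}}q^{\ell_A(w)}t^{\mathrm{del}_A(w)}=\sum_{w\in A_{n+1}}q^{\mathrm{rmaj}_{A_{n+1}}(w)}t^{\mathrm{del}_A(w)}=(1+2qt)(1+q+2q^2t)\cdots(1+q+\dots+q^{n-2}+2q^{n-1}t).$$
   Context: Permutations are in one-line notation and multiplied as functions, $(\sigma\tau)(k)=\sigma(\tau(k))$; $s_i=(i,i+1)$. $\mathrm{Des}_S(\pi)=\{i\in[n-1]:\pi(i)>\pi(i+1)\}$, $\mathrm{rmaj}_{S_n}(\pi)=\sum_{i\in\mathrm{Des}_S(\pi)}(n-i)$, $\ell_S(\pi)$ = number of inversions. For $1\le j\le n-1$ let $R^S_j=\{1,s_j,s_js_{j-1},\dots,s_j\cdots s_1\}$; every $w\in S_n$ factors uniquely as $w_1\cdots w_{n-1}$ with $w_j\in R^S_j$, and $\mathrm{del}_S(w)$ is the number of $j$ with $w_j=s_j\cdots s_1$. In $S_{n+1}$, $a_i=s_1s_{i+1}$ ($1\le i\le n-1$); $R^A_j=\{1,a_j,a_ja_{j-1},\dots,a_j\cdots a_2,a_j\cdots a_2a_1,a_j\cdots a_2a_1^{ -1}\}$ (words;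 $R^A_1=\{1,a_1,a_1^{ -1}\}$). Every $v\in A_{n+1}$ factors uniquely as $v_1\cdots v_{n-1}$ with $v_j\in R^A_j$; $\ell_A(v)$ = total number of letters $a_i^{\pm1}$, $\mathrm{del}_A(v)$ = number of letters $a_1^{\pm1}$. $\mathrm{Des}_A(\sigma)=\{1\le i\le n-1:\ell_A(\sigma)\ge\ell_A(\sigma a_i)\}$, $\mathrm{rmaj}_{A_{n+1}}(\sigma)=\sum_{i\in\mathrm{Des}_A(\sigma)}(n-i)$. -}

module Defs where

open import Data.Bool using (Bool; true; false; not; _∧_; if_then_else_)
open import Data.Nat using (ℕ; zero; suc; _∸_; _≡ᵇ_; _<ᵇ_; _%_) renaming (_+_ to _+ℕ_)
open import Data.List using (List; []; _∷_; _++_; map; concatMap; upTo; length; filterᵇ)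
open import Data.Nat.ListAction using (sum)
open import Data.Bool.ListAction using (any)
open import Data.Maybe using (Maybe; just; nothing; maybe)
open import Function using (id; _∘_)
open import Algebra.Bundles using (CommutativeSemiring)

-- Permutations of [m] = {1,…,m} in one-line notation: w = [w(1),…,w(m)].

range : ℕ → List ℕ
range m = map suc (upTo m)

words : ℕ → List ℕ → List (List ℕ)
words zero    xs = [] ∷ []
words (suc k) xs = concatMap (λ x → map (x ∷_) (words k xs)) xs

distinct : List ℕ → Bool
distinct []       = true
distinct (x ∷ xs) = not (any (x ≡ᵇ_) xs) ∧ distinct xs

Sym : ℕ → List (List ℕ)
Sym m = filterᵇ distinct (words m (range m))

-- w(k) for 1 ≤ k ≤ length w (identity outside)
app : List ℕ → ℕ → ℕ
app []      k             = k
app (x ∷ w) zero          = zero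
app (x ∷ w) (suc zero)    = x
app (x ∷ w) (suc (suc k)) = app w (suc k)

oneLine : ℕ → (ℕ → ℕ) → List ℕ
oneLine m f = map f (range m)

eqList : List ℕ → List ℕ → Bool
eqList []       []       = true
eqList (x ∷ xs) (y ∷ ys) = (x ≡ᵇ y) ∧ eqList xs ys
eqList _        _        = false

findFirst : {A : Set} → (A → Bool) → List A → Maybe A
findFirst p []       = nothing
findFirst p (x ∷ xs) = if p x then just x else findFirst p xs

count : {A : Set} → (A → Bool) → List A → ℕ
count p xs = length (filterᵇ p xs)

ℓS : List ℕ → ℕ
ℓS []       = 0
ℓS (x ∷ xs) = count (λ y → y <ᵇ x) xs +ℕ ℓS xs

rmajS : ℕ → List ℕ → ℕ
rmajS m w = sum (map (λ i → if app w (suc i) <ᵇ app w i then m ∸ i else 0) (range (m ∸ 1)))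

s : ℕ → ℕ → ℕ
s i k = if k ≡ᵇ i then suc i else (if k ≡ᵇ suc i then i else k)

evalWord : List (ℕ → ℕ) → ℕ → ℕ
evalWord []       = id
evalWord (x ∷ xs) = x ∘ evalWord xs

tuples : (ℕ → ℕ) → ℕ → List (List ℕ)
tuples bound zero    = [] ∷ []
tuples bound (suc r) = concatMap (λ ks → map (λ k → ks ++ (k ∷ [])) (upTo (bound (suc r)))) (tuples bound r)

indexed : {A : Set} → ℕ → List ℕ → (ℕ → ℕ → List A) → List A
indexed j []       f = []
indexed j (k ∷ ks) f = f j k ++ indexed (suc j) ks f

-- Type S factorisation: w = w₁ ⋯ w_{n-1}, w_j ∈ R^S_j = {1, s_j, s_j s_{j-1}, …, s_j ⋯ s_1}.
-- Choice k ∈ {0,…,j} stands for s_j s_{j-1} ⋯ s_{j-k+1} (k letters).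

factorS : ℕ → ℕ → List (ℕ → ℕ)
factorS j k = map (λ r → s (j ∸ r)) (upTo k)

tuplesS : ℕ → List (List ℕ)
tuplesS n = tuples suc (n ∸ 1)

permS : ℕ → List ℕ → List ℕ
permS n ks = oneLine n (evalWord (indexed 1 ks factorS))

-- number of j with w_j = s_j ⋯ s_1
delCountS : List ℕ → ℕ
delCountS ks = length (indexed 1 ks (λ j k → if k ≡ᵇ j then (0 ∷ []) else []))

-- del_S(σ): read off the (unique) factorisation of σ ∈ S_n
delS : ℕ → List ℕ → ℕ
delS n σ = maybe delCountS 0 (findFirst (λ ks → eqList (permS n ks) σ) (tuplesS n))

-- Type A: generators a_i = s₁ s_{i+1} of A_{n+1}, letters a_i and a_i⁻¹.

data Letter : Set where
  pos : ℕ → Letter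
  neg : ℕ → Letter

index : Letter → ℕ
index (pos i) = i
index (neg i) = i

act : Letter → ℕ → ℕ
act (pos i) = s 1 ∘ s (suc i)
act (neg i) = s (suc i) ∘ s 1

-- R^A_j: choice k ∈ {0,…,j} is a_j a_{j-1} ⋯ a_{j-k+1} (k letters);
-- choice k = j+1 is a_j ⋯ a_2 a_1⁻¹.
factorA : ℕ → ℕ → List Letter
factorA j k = if k <ᵇ suc j
              then map (λ r → pos (j ∸ r)) (upTo k)
              else map (λ r → pos (j ∸ r)) (upTo (j ∸ 1)) ++ (neg 1 ∷ [])

tuplesA : ℕ → List (List ℕ)
tuplesA n = tuples (suc ∘ suc) (n ∸ 1)

wordA : List ℕ → List Letter
wordA ks = indexed 1 ks factorA

permA : ℕ → List ℕ → List ℕ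
permA n ks = oneLine (suc n) (evalWord (map act (wordA ks)))

factWordA : ℕ → List ℕ → List Letter
factWordA n σ = maybe wordA [] (findFirst (λ ks → eqList (permA n ks) σ) (tuplesA n))

ℓA : ℕ → List ℕ → ℕ
ℓA n σ = length (factWordA n σ)

delA : ℕ → List ℕ → ℕ
delA n σ = count (λ x → index x ≡ᵇ 1) (factWordA n σ)

Alt : ℕ → List (List ℕ)
Alt n = filterᵇ (λ w → ℓS w % 2 ≡ᵇ 0) (Sym (suc n))

mulA : ℕ → List ℕ → ℕ → List ℕ
mulA n σ i = oneLine (suc n) (app σ ∘ act (pos i))

rmajA : ℕ → List ℕ → ℕ
rmajA n σ = sum (map (λ i → if ℓA n σ <ᵇ ℓA n (mulA n σ i) then 0 else n ∸ i) (range (n ∸ 1)))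

-- Generating functions, evaluated in an arbitrary commutative semiring
-- (taking R = ℕ[q,t] recovers the polynomial identity).

module _ {c ℓ} (R : CommutativeSemiring c ℓ) where
  open CommutativeSemiring R

  pow : Carrier → ℕ → Carrier
  pow x zero    = 1#
  pow x (suc k) = x * pow x k

  sumOver : {A : Set} → List A → (A → Carrier) → Carrier
  sumOver []       f = 0#
  sumOver (x ∷ xs) f = f x + sumOver xs f

  qint : Carrier → ℕ → Carrier
  qint q k = sumOver (upTo k) (pow q)

  prodS : ℕ → Carrier → Carrier → Carrier
  prodS n q t = go (n ∸ 1)
    where
    go : ℕ → Carrier
    go zero    = 1#
    go (suc k) = go k * (qint q (suc k) + pow q (suc k) * t)

  prodA : ℕ → Carrier → Carrier → Carrier
  prodA n q t = go (n ∸ 1)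
    where
    go : ℕ → Carrier
    go zero    = 1#
    go (suc k) = go k * (qint q (suc k) + (1# + 1#) * (pow q (suc k) * t))

{-# OPTIONS --safe #-}

-- Multiplying by the last factor w_{n-1} on the right inserts the letter n into a one-line word on
-- [n-1], with as many entries to its right as the factor has letters; the full factor s_{n-1} ⋯ s_1
-- puts n in front.  For the alternating group the picture is the same on words with two more letters
-- than factors, except that each letter a_i also exchanges the first two entries of the word; the two
-- choices a_j ⋯ a_2 a_1^{±1} insert the new maximum in the first or the second place.
--
-- Such an insertion changes the length by the number of letters of the factor.  For rmaj the increments
-- over all insertion places are 0, 1, 2, … in some order, the largest one belonging to the front
-- (for A: to the first two places).  To treat both groups at once, note that ℓ_A(σ) equals
-- Σ_j min(#{i < j : σ(i) > σ(j)}, j - 2), whence i ∈ Des_A(σ) if and only if σ(i+2) < max(σ(i+1), p),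
-- where p is the minimum of σ(1), …, σ(i); replacing p by 0 gives the ordinary descents.

module Submission where

open import Defs
open import Algebra.Bundles using (CommutativeSemiring)
import Algebra.Solver.Ring.NaturalCoefficients.Default as Solver
open import Data.Bool using (Bool; true; false; not; if_then_else_; T)
open import Data.Bool.ListAction using (any)
open import Data.Bool.Properties using (T?; not-involutive)
open import Data.Empty using (⊥-elim)
open import Data.List using (List; []; _∷_; _++_; _∷ʳ_; applyUpTo; map; concatMap; upTo; length; take; drop; cartesianProductWith)
open import Data.List.Properties using (map-++; map-∘; map-cong; map-cong-local; map-applyUpTo; map-id; length-map; length-upTo; upTo-∷ʳ; map-upTo; ++-identityʳ; ++-assoc; length-++; take++drop≡id; take-map; drop-map; ∷ʳ-injective; ∷-injective)
open import Data.List.Membership.Propositional using (_∈_; _∉_)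
open import Data.List.Membership.Propositional.Properties
open import Data.List.Membership.Propositional.Properties.WithK using (unique∧set⇒bag)
open import Data.List.Relation.Binary.BagAndSetEquality using (∼bag⇒↭)
open import Data.List.Relation.Binary.Permutation.Propositional using (_↭_; ↭-refl; ↭-sym; ↭-trans; ↭-prep; ↭-reflexive; ↭⇒↭ₛ)
import Data.List.Relation.Binary.Permutation.Propositional as Perm
open import Data.List.Relation.Binary.Permutation.Propositional.Properties using (∈-resp-↭; ↭-length; shift; drop-mid; ∷↭∷ʳ; ↭-singleton-inv)
import Data.List.Relation.Binary.Permutation.Setoid.Properties as PermSetoid
open import Data.List.Relation.Unary.All as All using (All; []; _∷_)
import Data.List.Relation.Unary.All.Properties as All
open import Data.List.Relation.Unary.AllPairs using ([]; _∷_)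
open import Data.List.Relation.Unary.Any using (here; there)
open import Data.List.Relation.Unary.Unique.Propositional using (Unique)
import Data.List.Relation.Unary.Unique.Propositional.Properties as Unique
open import Data.Maybe using (just; maybe)
open import Data.Nat using (ℕ; zero; suc; _+_; _∸_; _⊓_; _⊔_; _≤_; _<_; z≤n; s≤s; _≡ᵇ_; _<ᵇ_; _%_)
open import Data.Nat.ListAction using (sum)
open import Data.Nat.Properties
open import Data.Product using (_×_; _,_; proj₁; proj₂; ∃)
open import Data.Sum using (_⊎_; inj₁; inj₂)
open import Data.Unit using (⊤; tt)
open import Function using (id; _∘_; mk⇔)
open import Relation.Binary.Definitions using (tri<; tri≈; tri>)
open import Relation.Binary.PropositionalEquality
import Relation.Binary.Reasoning.Setoid as SetoidReasoning
open import Relation.Nullary using (¬_; yes; no; contradiction)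

-- The obstacle lies on the alternating side. `ℓA` is defined by searching for a factorisation, and
-- Des_A compares the lengths of σ and σ a_i, whose factorisations have no visible relation; only a
-- formula read off the one-line word makes the comparison local. The cap j - 2 in that formula
-- stems from the factors: inserting the maximum in the first or in the second place costs the same
-- number of letters, so the move from the second place to the front must be free. The cap also
-- makes the length, and with it rmaj, blind to an exchange of the first two entries, which is why
-- the exchanges made by the letters a_i can be ignored. The recursion for rmaj closes up because a
-- new maximum never changes the running minimum p of the letters before it. The power of t depends
-- on the exponent tuple alone and is constant off the top exponents; hence it is enough to know the
-- sum over the insertion places, and no bijection between the two statistics is needed.

range-∷ : ∀ m → range (suc m) ≡ 1 ∷ map suc (range m)
range-∷ m = cong (λ xs → 1 ∷ map suc xs) (sym (map-upTo suc m))

range-∷ʳ : ∀ m → range (suc m) ≡ range m ∷ʳ suc m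
range-∷ʳ m = trans (cong (map suc) (sym (upTo-∷ʳ m))) (map-++ suc (upTo m) (m ∷ []))

length-range : ∀ m → length (range m) ≡ m
length-range m = trans (length-map suc (upTo m)) (length-upTo m)

∈-range⁻ : ∀ {m x} → x ∈ range m → 1 ≤ x × x ≤ m
∈-range⁻ x∈ with ∈-map⁻ suc x∈
... | i , i∈ , refl = s≤s z≤n , ∈-upTo⁻ i∈

unique-range : ∀ m → Unique (range m)
unique-range m = Unique.map⁺ suc-injective (Unique.upTo⁺ m)

-- Adjacent transpositions and insertions on one-line notation

-- Position i is counted from 0, so swapAt i is right multiplication by s_{i+1}.
swapAt : ℕ → List ℕ → List ℕ
swapAt zero    (x ∷ y ∷ w) = y ∷ x ∷ w
swapAt zero    w           = w
swapAt (suc i) []          = []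
swapAt (suc i) (x ∷ w)     = x ∷ swapAt i w

map-swapAt : ∀ g i w → map g (swapAt i w) ≡ swapAt i (map g w)
map-swapAt g zero    []          = refl
map-swapAt g zero    (x ∷ [])    = refl
map-swapAt g zero    (x ∷ y ∷ w) = refl
map-swapAt g (suc i) []          = refl
map-swapAt g (suc i) (x ∷ w)     = cong (g x ∷_) (map-swapAt g i w)

swapAt-↭ : ∀ i w → swapAt i w ↭ w
swapAt-↭ zero    []          = ↭-refl
swapAt-↭ zero    (x ∷ [])    = ↭-refl
swapAt-↭ zero    (x ∷ y ∷ w) = Perm.swap y x ↭-refl
swapAt-↭ (suc i) []          = ↭-refl
swapAt-↭ (suc i) (x ∷ w)     = ↭-prep x (swapAt-↭ i w)

swapAt-involutive : ∀ i w → swapAt i (swapAt i w) ≡ w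
swapAt-involutive zero    []          = refl
swapAt-involutive zero    (x ∷ [])    = refl
swapAt-involutive zero    (x ∷ y ∷ w) = refl
swapAt-involutive (suc i) []          = refl
swapAt-involutive (suc i) (x ∷ w)     = cong (x ∷_) (swapAt-involutive i w)

s-suc : ∀ i k → s (suc i) (suc k) ≡ suc (s i k)
s-suc i k with k ≡ᵇ i | k ≡ᵇ suc i
... | true  | _     = refl
... | false | true  = refl
... | false | false = refl

map-s-range : ∀ i m → 2 + i ≤ m → map (s (suc i)) (range m) ≡ swapAt i (range m)
map-s-range zero (suc (suc m)) _ = cong (λ xs → 2 ∷ 1 ∷ xs) (begin
  map (s 1) (map suc (applyUpTo (2 +_) m))   ≡⟨ map-∘ (applyUpTo (2 +_) m) ⟨
  map (s 1 ∘ suc) (applyUpTo (2 +_) m)       ≡⟨ map-applyUpTo (2 +_) (s 1 ∘ suc) m ⟩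
  applyUpTo (3 +_) m                         ≡⟨ map-applyUpTo (2 +_) suc m ⟨
  map suc (applyUpTo (2 +_) m)               ∎)
  where open ≡-Reasoning
map-s-range zero (suc zero) (s≤s ())
map-s-range (suc i) (suc m) (s≤s i≤m)
  = subst (λ xs → map (s (2 + i)) xs ≡ swapAt (suc i) xs) (sym (range-∷ m)) (cong (1 ∷_) (begin
    map (s (2 + i)) (map suc (range m))   ≡⟨ map-∘ (range m) ⟨
    map (s (2 + i) ∘ suc) (range m)       ≡⟨ map-cong (s-suc (suc i)) (range m) ⟩
    map (suc ∘ s (suc i)) (range m)       ≡⟨ map-∘ (range m) ⟩
    map suc (map (s (suc i)) (range m))   ≡⟨ cong (map suc) (map-s-range i m i≤m) ⟩
    map suc (swapAt i (range m))          ≡⟨ map-swapAt suc i (range m) ⟩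
    swapAt i (map suc (range m))          ∎))
  where open ≡-Reasoning

map-∘s-range : ∀ g i m → 2 + i ≤ m → map (g ∘ s (suc i)) (range m) ≡ swapAt i (map g (range m))
map-∘s-range g i m i<m = begin
  map (g ∘ s (suc i)) (range m)       ≡⟨ map-∘ (range m) ⟩
  map g (map (s (suc i)) (range m))   ≡⟨ cong (map g) (map-s-range i m i<m) ⟩
  map g (swapAt i (range m))          ≡⟨ map-swapAt g i (range m) ⟩
  swapAt i (map g (range m))          ∎
  where open ≡-Reasoning

s-fixes : ∀ i x → suc i < x → s i x ≡ x
s-fixes i x i+1<x with x ≡ᵇ i in p | x ≡ᵇ suc i in q
... | true  | _     = ⊥-elim (<⇒≢ (<-trans (n<1+n i) i+1<x) (sym (≡ᵇ⇒≡ x i (subst T (sym p) _))))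
... | false | true  = ⊥-elim (<⇒≢ i+1<x (sym (≡ᵇ⇒≡ x (suc i) (subst T (sym q) _))))
... | false | false = refl

insAt : ℕ → ℕ → List ℕ → List ℕ
insAt p m u = take p u ++ m ∷ drop p u

insAt-↭ : ∀ p m u → insAt p m u ↭ m ∷ u
insAt-↭ p m u = ↭-trans (shift m (take p u) (drop p u)) (↭-reflexive (cong (m ∷_) (take++drop≡id p u)))

map-insAt : ∀ g p m u → map g (insAt p m u) ≡ insAt p (g m) (map g u)
map-insAt g p m u = trans (map-++ g (take p u) (m ∷ drop p u))
  (sym (cong₂ (λ v w → v ++ g m ∷ w) (take-map {f = g} p u) (drop-map {f = g} p u)))

insAt-length : ∀ m u → insAt (length u) m u ≡ u ∷ʳ m
insAt-length m []      = refl
insAt-length m (x ∷ u) = cong (x ∷_) (insAt-length m u)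

swapAt-insAt : ∀ p m u → p < length u → swapAt p (insAt (suc p) m u) ≡ insAt p m u
swapAt-insAt zero    m (x ∷ u) _         = refl
swapAt-insAt (suc p) m (x ∷ u) (s≤s p<u) = cong (x ∷_) (swapAt-insAt p m u p<u)

swapAt-zero-insAt : ∀ p m u → 2 + p ≤ length u → swapAt 0 (insAt (2 + p) m u) ≡ insAt (2 + p) m (swapAt 0 u)
swapAt-zero-insAt p m (x ∷ y ∷ u) _ = refl
swapAt-zero-insAt p m (x ∷ []) (s≤s ())

-- The place of the fresh letter determines p, and deleting it gives back u. Beyond the end of a
-- word all insertions coincide, hence the bounds on p and q.
insAt-injective : ∀ p q {m} u v → p ≤ length u → q ≤ length v → m ∉ u → m ∉ v →
                  insAt p m u ≡ insAt q m v → p ≡ q × u ≡ v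
insAt-injective zero    zero    u       v       _ _ _ _ e = refl , proj₂ (∷-injective e)
insAt-injective zero    (suc q) u       (y ∷ v) _ _ _ m∉ e = ⊥-elim (m∉ (here (proj₁ (∷-injective e))))
insAt-injective (suc p) zero    (x ∷ u) v       _ _ m∉ _ e = ⊥-elim (m∉ (here (sym (proj₁ (∷-injective e)))))
insAt-injective (suc p) (suc q) (x ∷ u) (y ∷ v) (s≤s p≤) (s≤s q≤) m∉u m∉v e
  with ∷-injective e
... | refl , e′ with insAt-injective p q u v p≤ q≤ (m∉u ∘ there) (m∉v ∘ there) e′
...   | refl , refl = refl , refl

++-insAt : ∀ u {v} {m} → u ++ m ∷ v ≡ insAt (length u) m (u ++ v)
++-insAt []      = refl
++-insAt (x ∷ u) = cong (x ∷_) (++-insAt u)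

-- Insertion of m with k entries to its right.
ins : ℕ → ℕ → List ℕ → List ℕ
ins k m u = insAt (length u ∸ k) m u

ins-↭ : ∀ k m u → ins k m u ↭ m ∷ u
ins-↭ k m u = insAt-↭ (length u ∸ k) m u

ins-∷ : ∀ {k} m x u → k ≤ length u → ins k m (x ∷ u) ≡ x ∷ ins k m u
ins-∷ m x u k≤ = cong (λ p → insAt p m (x ∷ u)) (+-∸-assoc 1 k≤)

ins-length : ∀ m u → ins (length u) m u ≡ m ∷ u
ins-length m u = cong (λ p → insAt p m u) (n∸n≡0 (length u))

ins-injective : ∀ {j k m} u v → j ≤ length u → k ≤ length u → length u ≡ length v →
                m ∉ u → m ∉ v → ins j m u ≡ ins k m v → j ≡ k × u ≡ v
ins-injective {j} {k} u v j≤ k≤ u≡v m∉u m∉v e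
  with insAt-injective (length u ∸ j) (length v ∸ k) u v (m∸n≤m (length u) j) (m∸n≤m (length v) k) m∉u m∉v e
... | p≡q , refl = ∸-cancelˡ-≡ j≤ k≤ p≡q , refl

++-ins : ∀ u v {m} → u ++ m ∷ v ≡ ins (length v) m (u ++ v)
++-ins u v {m} = trans (++-insAt u)
  (cong (λ p → insAt p m (u ++ v)) (sym (trans (cong (_∸ length v) (length-++ u)) (m+n∸n≡m (length u) (length v)))))

swap^ : ℕ → List ℕ → List ℕ
swap^ zero    u = u
swap^ (suc k) u = swapAt 0 (swap^ k u)

swap^-↭ : ∀ k u → swap^ k u ↭ u
swap^-↭ zero    u = ↭-refl
swap^-↭ (suc k) u = ↭-trans (swapAt-↭ 0 (swap^ k u)) (swap^-↭ k u)

swap^-comm : ∀ k u → swap^ k (swapAt 0 u) ≡ swapAt 0 (swap^ k u)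
swap^-comm zero    u = refl
swap^-comm (suc k) u = cong (swapAt 0) (swap^-comm k u)

swap^-involutive : ∀ k u → swap^ k (swap^ k u) ≡ u
swap^-involutive zero    u = refl
swap^-involutive (suc k) u = trans (cong (swapAt 0) (swap^-comm k (swap^ k u)))
  (trans (swapAt-involutive 0 _) (swap^-involutive k u))

map-swap^ : ∀ g k u → map g (swap^ k u) ≡ swap^ k (map g u)
map-swap^ g zero    u = refl
map-swap^ g (suc k) u = trans (map-swapAt g 0 (swap^ k u)) (cong (swapAt 0) (map-swap^ g k u))

-- Duplicate-free lists

unique-resp-↭ : ∀ {A : Set} {xs ys : List A} → xs ↭ ys → Unique xs → Unique ys
unique-resp-↭ {A} p = PermSetoid.Unique-resp-↭ (setoid A) (↭⇒↭ₛ p)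

-- Pigeonhole, by deleting one common element at a time. It turns the membership test of `Sym`,
-- distinct entries taken from [m], into being a rearrangement of [m].
unique∧⊆⇒↭ : ∀ {A : Set} (xs ys : List A) → Unique xs → (∀ {x} → x ∈ xs → x ∈ ys) →
             length ys ≤ length xs → xs ↭ ys
unique∧⊆⇒↭ []       []       _          _    _ = ↭-refl
unique∧⊆⇒↭ (x ∷ xs) ys (x∉xs ∷ u) xs⊆ys len
  with ∈-∃++ (xs⊆ys (here refl))
... | as , bs , refl = ↭-trans (↭-prep x rec) (↭-sym (shift x as bs))
  where
  rec : xs ↭ as ++ bs
  rec = unique∧⊆⇒↭ xs (as ++ bs) u
    (λ {y} y∈ → drop-x (All.lookup x∉xs y∈ ∘ sym) (∈-resp-↭ (shift x as bs) (xs⊆ys (there y∈))))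
    (≤-pred (≤-trans (≤-reflexive (sym (↭-length (shift x as bs)))) len))
    where
    drop-x : ∀ {y zs} → ¬ y ≡ x → y ∈ x ∷ zs → y ∈ zs
    drop-x y≢x (here y≡x)  = ⊥-elim (y≢x y≡x)
    drop-x y≢x (there y∈) = y∈

unique-map : ∀ {A B : Set} {f : A → B} {xs} → (∀ {x y} → x ∈ xs → y ∈ xs → f x ≡ f y → x ≡ y) →
             Unique xs → Unique (map f xs)
unique-map inj []         = []
unique-map inj (x∉ ∷ u) =
  All.map⁺ (All.tabulate (λ y∈ fx≡fy → All.lookup x∉ y∈ (inj (here refl) (there y∈) fx≡fy)))
  ∷ unique-map (λ x∈ y∈ → inj (there x∈) (there y∈)) u

unique∧same⇒↭ : ∀ {A : Set} {xs ys : List A} → Unique xs → Unique ys →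
  (∀ {x} → x ∈ xs → x ∈ ys) → (∀ {x} → x ∈ ys → x ∈ xs) → xs ↭ ys
unique∧same⇒↭ u v f g = ∼bag⇒↭ (unique∧set⇒bag u v (mk⇔ f g))

concatMap-map : ∀ {A B C : Set} (f : A → B → C) xs ys →
                concatMap (λ x → map (f x) ys) xs ≡ cartesianProductWith f xs ys
concatMap-map f []       ys = refl
concatMap-map f (x ∷ xs) ys = cong (map (f x) ys ++_) (concatMap-map f xs ys)

any≡false⇒≢ : ∀ x w → any (x ≡ᵇ_) w ≡ false → All (x ≢_) w
any≡false⇒≢ x []      _ = []
any≡false⇒≢ x (y ∷ w) e with x ≡ᵇ y in f
... | false = (λ x≡y → subst T f (≡⇒≡ᵇ x y x≡y)) ∷ any≡false⇒≢ x w e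

≢⇒any≡false : ∀ x w → All (x ≢_) w → any (x ≡ᵇ_) w ≡ false
≢⇒any≡false x []      _         = refl
≢⇒any≡false x (y ∷ w) (x≢y ∷ a) with x ≡ᵇ y in f
... | false = ≢⇒any≡false x w a
... | true  = ⊥-elim (x≢y (≡ᵇ⇒≡ x y (subst T (sym f) _)))

distinct⇒unique : ∀ w → T (distinct w) → Unique w
distinct⇒unique []      _ = []
distinct⇒unique (x ∷ w) d with any (x ≡ᵇ_) w in e
... | false = any≡false⇒≢ x w e ∷ distinct⇒unique w d

unique⇒distinct : ∀ w → Unique w → T (distinct w)
unique⇒distinct []      _        = _
unique⇒distinct (x ∷ w) (x∉ ∷ u) rewrite ≢⇒any≡false x w x∉ = unique⇒distinct w u

-- One-line words as rearrangements of [m]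

words-suc : ∀ k xs → words (suc k) xs ≡ cartesianProductWith _∷_ xs (words k xs)
words-suc k xs = concatMap-map _∷_ xs (words k xs)

unique-words : ∀ k {xs} → Unique xs → Unique (words k xs)
unique-words zero         u = [] ∷ []
unique-words (suc k) {xs} u = subst Unique (sym (words-suc k xs))
  (Unique.cartesianProductWith⁺ _∷_ ∷-injective u (unique-words k u))

∈-words⁻ : ∀ k {xs w} → w ∈ words k xs → length w ≡ k × All (_∈ xs) w
∈-words⁻ zero (here refl) = refl , []
∈-words⁻ (suc k) {xs} {w} w∈
  with ∈-cartesianProductWith⁻ _∷_ xs (words k xs) (subst (w ∈_) (words-suc k xs) w∈)
... | x , v , x∈ , v∈ , refl with ∈-words⁻ k v∈
...   | l , a = cong suc l , x∈ ∷ a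

∈-words⁺ : ∀ k {xs w} → length w ≡ k → All (_∈ xs) w → w ∈ words k xs
∈-words⁺ zero    {w = []}         _ _        = here refl
∈-words⁺ (suc k) {xs} {w@(x ∷ v)} l (x∈ ∷ a) = subst (w ∈_) (sym (words-suc k xs))
  (∈-cartesianProductWith⁺ _∷_ x∈ (∈-words⁺ k (suc-injective l) a))

unique-Sym : ∀ m → Unique (Sym m)
unique-Sym m = Unique.filter⁺ (T? ∘ distinct) (unique-words m (unique-range m))

∈-Sym⁻ : ∀ {m w} → w ∈ Sym m → w ↭ range m
∈-Sym⁻ {m} {w} w∈ with ∈-filter⁻ (T? ∘ distinct) w∈
... | w∈words , d with ∈-words⁻ m w∈words
...   | l , a = unique∧⊆⇒↭ w (range m) (distinct⇒unique w d) (All.lookup a)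
                  (≤-reflexive (trans (length-range m) (sym l)))

∈-Sym⁺ : ∀ {m w} → w ↭ range m → w ∈ Sym m
∈-Sym⁺ {m} {w} w↭ = ∈-filter⁺ (T? ∘ distinct)
  (∈-words⁺ m (trans (↭-length w↭) (length-range m)) (All.tabulate (∈-resp-↭ w↭)))
  (unique⇒distinct w (unique-resp-↭ (↭-sym w↭) (unique-range m)))

-- Exponent tuples

data Tuple (bound : ℕ → ℕ) : ℕ → List ℕ → Set where
  []   : Tuple bound 0 []
  snoc : ∀ {r ks k} → Tuple bound r ks → k < bound (suc r) → Tuple bound (suc r) (ks ∷ʳ k)

length-Tuple : ∀ {b r ks} → Tuple b r ks → length ks ≡ r
length-Tuple []       = refl
length-Tuple (snoc {ks = ks} τ _) = trans (length-++ ks) (trans (+-comm (length ks) 1) (cong suc (length-Tuple τ)))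

tuples-suc : ∀ b r → tuples b (suc r) ≡ cartesianProductWith _∷ʳ_ (tuples b r) (upTo (b (suc r)))
tuples-suc b r = concatMap-map _∷ʳ_ (tuples b r) (upTo (b (suc r)))

unique-tuples : ∀ b r → Unique (tuples b r)
unique-tuples b zero    = [] ∷ []
unique-tuples b (suc r) = subst Unique (sym (tuples-suc b r))
  (Unique.cartesianProductWith⁺ _∷ʳ_ (λ {ks} {js} → ∷ʳ-injective ks js) (unique-tuples b r) (Unique.upTo⁺ (b (suc r))))

∈-tuples⁻ : ∀ {b} r {ks} → ks ∈ tuples b r → Tuple b r ks
∈-tuples⁻ zero (here refl) = []
∈-tuples⁻ {b} (suc r) {ks} ks∈
  with ∈-cartesianProductWith⁻ _∷ʳ_ (tuples b r) (upTo (b (suc r))) (subst (ks ∈_) (tuples-suc b r) ks∈)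
... | js , k , js∈ , k∈ , refl = snoc (∈-tuples⁻ r js∈) (∈-upTo⁻ k∈)

∈-tuples⁺ : ∀ {b r ks} → Tuple b r ks → ks ∈ tuples b r
∈-tuples⁺ []                             = here refl
∈-tuples⁺ {b} (snoc {r} {ks} {k} τ k<) = subst (ks ∷ʳ k ∈_) (sym (tuples-suc b r))
  (∈-cartesianProductWith⁺ _∷ʳ_ (∈-tuples⁺ τ) (∈-upTo⁺ k<))

eqList-sound : ∀ u v → eqList u v ≡ true → u ≡ v
eqList-sound []      []      _ = refl
eqList-sound (x ∷ u) (y ∷ v) e with x ≡ᵇ y in f
... | true = cong₂ _∷_ (≡ᵇ⇒≡ x y (subst T (sym f) tt)) (eqList-sound u v e)

eqList-refl : ∀ u → eqList u u ≡ true
eqList-refl []      = refl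
eqList-refl (x ∷ u) with x ≡ᵇ x in f
... | true  = eqList-refl u
... | false = ⊥-elim (subst T f (≡⇒≡ᵇ x x refl))

-- Serves to evaluate `delS` and `factWordA` on the word of a given tuple; injectivity of the
-- factorisation supplies the uniqueness.
findFirst-unique : ∀ {A : Set} (p : A → Bool) {xs x} → x ∈ xs → p x ≡ true →
                   (∀ {y} → y ∈ xs → p y ≡ true → y ≡ x) → findFirst p xs ≡ just x
findFirst-unique p {y ∷ xs} x∈ px uniq with p y in py
... | true = cong just (uniq (here refl) py)
... | false with x∈
...   | here refl = contradiction (trans (sym px) py) (λ ())
...   | there x∈′ = findFirst-unique p x∈′ px (uniq ∘ there)

suc∉ : ∀ {m u} → u ↭ range m → suc m ∉ u
suc∉ u↭ m∈ = 1+n≰n (proj₂ (∈-range⁻ (∈-resp-↭ u↭ m∈)))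

all-< : ∀ {m u} → u ↭ range m → All (_< suc m) u
all-< u↭ = All.tabulate (λ x∈ → s≤s (proj₂ (∈-range⁻ (∈-resp-↭ u↭ x∈))))

-- bound r is both the number of choices for the r-th exponent and the size of the words built from r factors.
module Enumeration
  (bound : ℕ → ℕ) (bound-suc : ∀ r → bound (suc r) ≡ suc (bound r))
  (twist : ℕ → List ℕ → List ℕ)
  (twist-↭ : ∀ k u → twist k u ↭ u)
  (twist-involutive : ∀ k u → twist k (twist k u) ≡ u)
  (perm : ℕ → List ℕ → List ℕ)
  (Good : List ℕ → Set)
  (good⁺ : ∀ {r k u} → u ↭ range (bound r) → k ≤ bound r → Good u → Good (ins k (suc (bound r)) (twist k u)))
  (good⁻ : ∀ {r k u} → u ↭ range (bound r) → k ≤ bound r → Good (ins k (suc (bound r)) (twist k u)) → Good u)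
  (perm-[] : perm 0 [] ↭ range (bound 0) × Good (perm 0 []))
  (perm-[]-unique : ∀ {w} → w ↭ range (bound 0) → Good w → w ≡ perm 0 [])
  (perm-∷ʳ : ∀ {r ks k} → Tuple bound r ks → k ≤ bound r →
             perm (suc r) (ks ∷ʳ k) ≡ ins k (suc (bound r)) (twist k (perm r ks)))
  where

  private
    k≤bound : ∀ {r k} → k < bound (suc r) → k ≤ bound r
    k≤bound {r} {k} k< = ≤-pred (subst (k <_) (bound-suc r) k<)

    range-bound : ∀ r → range (bound (suc r)) ≡ range (bound r) ∷ʳ suc (bound r)
    range-bound r = trans (cong range (bound-suc r)) (range-∷ʳ (bound r))

  perm-valid : ∀ {r ks} → Tuple bound r ks → perm r ks ↭ range (bound r) × Good (perm r ks)
  perm-valid [] = perm-[]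
  perm-valid (snoc {r} {ks} {k} τ k<) with perm-valid τ
  ... | p↭ , good = subst (λ w → w ↭ range (bound (suc r)) × Good w) (sym (perm-∷ʳ τ (k≤bound k<)))
    ( ↭-trans (ins-↭ k _ _) (↭-trans (↭-prep _ (↭-trans (twist-↭ k _) p↭))
        (↭-trans (∷↭∷ʳ _ _) (↭-reflexive (sym (range-bound r)))))
    , good⁺ {r} p↭ (k≤bound k<) good )

  perm-injective : ∀ {r ks js} → Tuple bound r ks → Tuple bound r js → perm r ks ≡ perm r js → ks ≡ js
  perm-injective [] [] _ = refl
  perm-injective (snoc {r} {ks} {k} σ k<) (snoc {ks = js} {j} τ j<) e
    with ins-injective u v (k≤u k< u↭) (k≤u j< u↭) (trans (length-u u↭) (sym (length-u v↭)))
           (suc∉ u↭) (suc∉ v↭)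
           (trans (sym (perm-∷ʳ σ (k≤bound k<))) (trans e (perm-∷ʳ τ (k≤bound j<))))
    where
    u = twist k (perm r ks)
    v = twist j (perm r js)
    u↭ : u ↭ range (bound r)
    u↭ = ↭-trans (twist-↭ k _) (proj₁ (perm-valid σ))
    v↭ : v ↭ range (bound r)
    v↭ = ↭-trans (twist-↭ j _) (proj₁ (perm-valid τ))
    length-u : ∀ {w} → w ↭ range (bound r) → length w ≡ bound r
    length-u w↭ = trans (↭-length w↭) (length-range (bound r))
    k≤u : ∀ {i w} → i < bound (suc r) → w ↭ range (bound r) → i ≤ length w
    k≤u i< w↭ = ≤-trans (k≤bound i<) (≤-reflexive (sym (length-u w↭)))
  -- The exponents agree by now, so both words carry the same twist, which can be undone.
  ... | refl , u≡v = cong (_∷ʳ k) (perm-injective σ τ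
    (trans (sym (twist-involutive k _)) (trans (cong (twist k) u≡v) (twist-involutive k _))))

  -- The factorisation is read off from its right end: the number of letters behind the maximum is
  -- the last exponent k, and since `twist k` is its own inverse, applying it to the remaining
  -- letters gives the word of the preceding factors.
  perm-surjective : ∀ r {w} → w ↭ range (bound r) → Good w → ∃ λ ks → Tuple bound r ks × w ≡ perm r ks
  perm-surjective zero w↭ good = [] , [] , perm-[]-unique w↭ good
  perm-surjective (suc r) w↭ good
    with ∈-∃++ (∈-resp-↭ (↭-sym (↭-trans w↭ (↭-reflexive (range-bound r)))) (∈-insert (range (bound r))))
  ... | u , v , refl = ks ∷ʳ k , snoc τ (≤-trans (s≤s k≤) (≤-reflexive (sym (bound-suc r)))) ,
    trans w≡ (trans (cong (λ x → ins k _ (twist k x)) (proj₂ (proj₂ rec))) (sym (perm-∷ʳ τ k≤)))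
    where
    k = length v
    uv↭ : u ++ v ↭ range (bound r)
    uv↭ = ↭-trans (drop-mid u (range (bound r)) (↭-trans w↭ (↭-reflexive (range-bound r))))
      (↭-reflexive (++-identityʳ _))
    twisted↭ : twist k (u ++ v) ↭ range (bound r)
    twisted↭ = ↭-trans (twist-↭ k _) uv↭
    k≤ : k ≤ bound r
    k≤ = ≤-trans (m≤n+m k (length u)) (≤-reflexive
      (trans (sym (length-++ u)) (trans (↭-length uv↭) (length-range (bound r)))))
    w≡ : u ++ suc (bound r) ∷ v ≡ ins k (suc (bound r)) (twist k (twist k (u ++ v)))
    w≡ = trans (++-ins u v) (cong (ins k _) (sym (twist-involutive k _)))
    rec = perm-surjective r twisted↭ (good⁻ {r} {k} twisted↭ k≤ (subst Good w≡ good))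
    ks = proj₁ rec
    τ = proj₁ (proj₂ rec)

  enumerates : ∀ r {L} → Unique L → (∀ {w} → w ∈ L → w ↭ range (bound r) × Good w) →
               (∀ {w} → w ↭ range (bound r) × Good w → w ∈ L) → L ↭ map (perm r) (tuples bound r)
  enumerates r {L} uL ∈L⁻ ∈L⁺ = unique∧same⇒↭ uL
    (unique-map (λ ks∈ js∈ → perm-injective (∈-tuples⁻ r ks∈) (∈-tuples⁻ r js∈)) (unique-tuples bound r))
    to from
    where
    to : ∀ {w} → w ∈ L → w ∈ map (perm r) (tuples bound r)
    to w∈ with ∈L⁻ w∈
    ... | w↭ , good with perm-surjective r w↭ good
    ...   | ks , τ , refl = ∈-map⁺ (perm r) (∈-tuples⁺ τ)
    from : ∀ {w} → w ∈ map (perm r) (tuples bound r) → w ∈ L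
    from w∈ with ∈-map⁻ (perm r) w∈
    ... | ks , ks∈ , refl = ∈L⁺ (perm-valid (∈-tuples⁻ r ks∈))

  findFirst-perm : ∀ {r ks} → Tuple bound r ks →
                   findFirst (λ js → eqList (perm r js) (perm r ks)) (tuples bound r) ≡ just ks
  findFirst-perm {r} {ks} τ = findFirst-unique _ (∈-tuples⁺ τ) (eqList-refl (perm r ks))
    (λ {js} js∈ e → perm-injective (∈-tuples⁻ r js∈) τ (eqList-sound (perm r js) (perm r ks) e))

-- Evaluation of words of factors on one-line notation

evalWord-++ : ∀ xs ys x → evalWord (xs ++ ys) x ≡ evalWord xs (evalWord ys x)
evalWord-++ []       ys x = refl
evalWord-++ (f ∷ xs) ys x = cong f (evalWord-++ xs ys x)

evalWord-fixes : ∀ {fs x} → All (λ f → f x ≡ x) fs → evalWord fs x ≡ x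
evalWord-fixes []                = refl
evalWord-fixes {f ∷ fs} (e ∷ es) = trans (cong f (evalWord-fixes es)) e

indexed-∷ʳ : ∀ {A : Set} j ks k (f : ℕ → ℕ → List A) →
             indexed j (ks ∷ʳ k) f ≡ indexed j ks f ++ f (j + length ks) k
indexed-∷ʳ j []       k f rewrite +-identityʳ j = ++-identityʳ (f j k)
indexed-∷ʳ j (x ∷ ks) k f rewrite +-suc j (length ks) =
  trans (cong (f j x ++_) (indexed-∷ʳ (suc j) ks k f)) (sym (++-assoc (f j x) _ _))

indexed-Tuple : ∀ {A : Set} {b r ks} k (f : ℕ → ℕ → List A) → Tuple b r ks →
                indexed 1 (ks ∷ʳ k) f ≡ indexed 1 ks f ++ f (suc r) k
indexed-Tuple {ks = ks} k f τ = trans (indexed-∷ʳ 1 ks k f) (cong (λ i → indexed 1 ks f ++ f (suc i) k) (length-Tuple τ))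

All-indexed : ∀ {A : Set} {P : A → Set} j ks {n} (f : ℕ → ℕ → List A) →
              (∀ i k → j ≤ i → i < n → All P (f i k)) → j + length ks ≤ n → All P (indexed j ks f)
All-indexed j []       f h _ = []
All-indexed j (k ∷ ks) {n} f h le =
  All.++⁺ (h j k ≤-refl (≤-trans (s≤s (m≤m+n j (length ks))) le′))
          (All-indexed (suc j) ks f (λ i k j<i → h i k (<⇒≤ j<i)) le′)
  where
  le′ : suc j + length ks ≤ n
  le′ = subst (_≤ n) (+-suc j (length ks)) le

length-oneLine : ∀ n f → length (oneLine n f) ≡ n
length-oneLine n f = trans (length-map f (range n)) (length-range n)

factorS-suc : ∀ j k x → evalWord (factorS j (suc k)) x ≡ evalWord (factorS j k) (s (j ∸ k) x)
factorS-suc j k x = trans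
  (cong (λ fs → evalWord fs x) (trans (cong (map _) (sym (upTo-∷ʳ k))) (map-++ _ (upTo k) (k ∷ []))))
  (evalWord-++ (factorS j k) (s (j ∸ k) ∷ []) x)

-- The factor s_j ⋯ s_{j-k+1} carries the last entry k places to the left.
factorS-insAt : ∀ j k p → k + p ≡ j →
                map (evalWord (factorS j k)) (range (suc j)) ≡ insAt p (suc j) (range j)
factorS-insAt j zero p refl = begin
  map id (range (suc j))                    ≡⟨ map-id (range (suc j)) ⟩
  range (suc j)                             ≡⟨ range-∷ʳ j ⟩
  range j ∷ʳ suc j                          ≡⟨ insAt-length (suc j) (range j) ⟨
  insAt (length (range j)) (suc j) (range j) ≡⟨ cong (λ i → insAt i (suc j) (range j)) (length-range j) ⟩
  insAt j (suc j) (range j)                 ∎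
  where open ≡-Reasoning
factorS-insAt j (suc k) p e = begin
  map (evalWord (factorS j (suc k))) (range (suc j))
    ≡⟨ map-cong (factorS-suc j k) (range (suc j)) ⟩
  map (evalWord (factorS j k) ∘ s (j ∸ k)) (range (suc j))
    ≡⟨ cong (λ i → map (evalWord (factorS j k) ∘ s i) (range (suc j))) j∸k ⟩
  map (evalWord (factorS j k) ∘ s (suc p)) (range (suc j))
    ≡⟨ map-∘s-range (evalWord (factorS j k)) p (suc j) (s≤s p<j) ⟩
  swapAt p (map (evalWord (factorS j k)) (range (suc j)))
    ≡⟨ cong (swapAt p) (factorS-insAt j k (suc p) e′) ⟩
  swapAt p (insAt (suc p) (suc j) (range j))
    ≡⟨ swapAt-insAt p (suc j) (range j) (subst (p <_) (sym (length-range j)) p<j) ⟩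
  insAt p (suc j) (range j) ∎
  where
  open ≡-Reasoning
  e′ : k + suc p ≡ j
  e′ = trans (+-suc k p) e
  j∸k : j ∸ k ≡ suc p
  j∸k = trans (cong (_∸ k) (sym e′)) (m+n∸m≡n k (suc p))
  p<j : p < j
  p<j = subst (p <_) e (s≤s (m≤n+m p k))

factorS-fixes : ∀ x i k → suc i < x → All (λ f → f x ≡ x) (factorS i k)
factorS-fixes x i k i< = All.map⁺ (All.tabulate (λ {r} _ → s-fixes (i ∸ r) x (≤-trans (s≤s (s≤s (m∸n≤m i r))) i<)))

-- The last factor acts first and rearranges positions, which is an insertion into the identity
-- word; the preceding factors then rename the values, and they fix the new maximum.
permS-∷ʳ : ∀ {r ks k} → Tuple suc r ks → k ≤ suc r →
           permS (2 + r) (ks ∷ʳ k) ≡ ins k (2 + r) (permS (suc r) ks)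
permS-∷ʳ {r} {ks} {k} τ k≤ = begin
  map (evalWord (indexed 1 (ks ∷ʳ k) factorS)) (range (2 + r))
    ≡⟨ cong (λ fs → map (evalWord fs) (range (2 + r))) (indexed-Tuple k factorS τ) ⟩
  map (evalWord (indexed 1 ks factorS ++ factorS (suc r) k)) (range (2 + r))
    ≡⟨ map-cong (evalWord-++ (indexed 1 ks factorS) (factorS (suc r) k)) (range (2 + r)) ⟩
  map (E ∘ evalWord (factorS (suc r) k)) (range (2 + r))
    ≡⟨ map-∘ (range (2 + r)) ⟩
  map E (map (evalWord (factorS (suc r) k)) (range (2 + r)))
    ≡⟨ cong (map E) (factorS-insAt (suc r) k p (m+[n∸m]≡n k≤)) ⟩
  map E (insAt p (2 + r) (range (suc r)))
    ≡⟨ map-insAt E p (2 + r) (range (suc r)) ⟩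
  insAt p (E (2 + r)) (permS (suc r) ks)
    ≡⟨ cong (λ x → insAt p x (permS (suc r) ks)) E-fixes ⟩
  insAt p (2 + r) (permS (suc r) ks)
    ≡⟨ cong (λ l → insAt (l ∸ k) (2 + r) (permS (suc r) ks)) (length-oneLine (suc r) E) ⟨
  ins k (2 + r) (permS (suc r) ks) ∎
  where
  open ≡-Reasoning
  E = evalWord (indexed 1 ks factorS)
  p = suc r ∸ k
  E-fixes : E (2 + r) ≡ 2 + r
  E-fixes = evalWord-fixes (All-indexed 1 ks factorS (λ i k _ i< → factorS-fixes (2 + r) i k (s≤s i<))
    (s≤s (≤-reflexive (length-Tuple τ))))

-- Shared by both branches of `factorA`: for k = j - 1 it is the stem a_j ⋯ a_2 that stands before
-- a_1⁻¹.
prefixA : ℕ → ℕ → List Letter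
prefixA j k = map (λ r → pos (j ∸ r)) (upTo k)

evalA : List Letter → ℕ → ℕ
evalA = evalWord ∘ map act

evalA-++ : ∀ xs ys x → evalA (xs ++ ys) x ≡ evalA xs (evalA ys x)
evalA-++ xs ys x = trans (cong (λ fs → evalWord fs x) (map-++ act xs ys)) (evalWord-++ (map act xs) (map act ys) x)

prefixA-∷ʳ : ∀ j k → prefixA j (suc k) ≡ prefixA j k ∷ʳ pos (j ∸ k)
prefixA-∷ʳ j k = trans (cong (map _) (sym (upTo-∷ʳ k))) (map-++ _ (upTo k) (k ∷ []))

prefixA-suc : ∀ j k x → evalA (prefixA j (suc k)) x ≡ evalA (prefixA j k) (act (pos (j ∸ k)) x)
prefixA-suc j k x = trans (cong (λ ls → evalA ls x) (prefixA-∷ʳ j k)) (evalA-++ (prefixA j k) (pos (j ∸ k) ∷ []) x)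

length-swap^-range : ∀ k m → length (swap^ k (range m)) ≡ m
length-swap^-range k m = trans (↭-length (swap^-↭ k (range m))) (length-range m)

-- Each letter exchanges the first two entries, and then carries the maximum one place to the left.
prefixA-insAt : ∀ j k p → k + p ≡ j →
                map (evalA (prefixA j k)) (range (2 + j)) ≡ insAt (suc p) (2 + j) (swap^ k (range (suc j)))
prefixA-insAt j zero p refl = begin
  map id (range (2 + j))                    ≡⟨ map-id (range (2 + j)) ⟩
  range (2 + j)                             ≡⟨ range-∷ʳ (suc j) ⟩
  range (suc j) ∷ʳ (2 + j)                          ≡⟨ insAt-length (2 + j) (range (suc j)) ⟨
  insAt (length (range (suc j))) (2 + j) (range (suc j)) ≡⟨ cong (λ i → insAt i (2 + j) (range (suc j))) (length-range (suc j)) ⟩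
  insAt (suc j) (2 + j) (range (suc j))                 ∎
  where open ≡-Reasoning
prefixA-insAt j (suc k) p e = begin
  map (evalA (prefixA j (suc k))) (range (2 + j))
    ≡⟨ map-cong (prefixA-suc j k) (range (2 + j)) ⟩
  map (G ∘ act (pos (j ∸ k))) (range (2 + j))
    ≡⟨ cong (λ i → map (G ∘ act (pos i)) (range (2 + j))) j∸k ⟩
  map (G ∘ s 1 ∘ s (2 + p)) (range (2 + j))
    ≡⟨ map-∘s-range (G ∘ s 1) (suc p) (2 + j) (s≤s (s≤s p<j)) ⟩
  swapAt (suc p) (map (G ∘ s 1) (range (2 + j)))
    ≡⟨ cong (swapAt (suc p)) (map-∘s-range G 0 (2 + j) (s≤s (s≤s z≤n))) ⟩
  swapAt (suc p) (swapAt 0 (map G (range (2 + j))))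
    ≡⟨ cong (swapAt (suc p) ∘ swapAt 0) (prefixA-insAt j k (suc p) e′) ⟩
  swapAt (suc p) (swapAt 0 (insAt (2 + p) (2 + j) (swap^ k (range (suc j)))))
    ≡⟨ cong (swapAt (suc p)) (swapAt-zero-insAt p (2 + j) (swap^ k (range (suc j)))
         (subst (2 + p ≤_) (sym (length-swap^-range k (suc j))) (s≤s p<j))) ⟩
  swapAt (suc p) (insAt (2 + p) (2 + j) (swap^ (suc k) (range (suc j))))
    ≡⟨ swapAt-insAt (suc p) (2 + j) (swap^ (suc k) (range (suc j)))
         (subst (suc p <_) (sym (length-swap^-range (suc k) (suc j))) (s≤s p<j)) ⟩
  insAt (suc p) (2 + j) (swap^ (suc k) (range (suc j))) ∎
  where
  open ≡-Reasoning
  G = evalA (prefixA j k)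
  e′ : k + suc p ≡ j
  e′ = trans (+-suc k p) e
  j∸k : j ∸ k ≡ suc p
  j∸k = trans (cong (_∸ k) (sym e′)) (m+n∸m≡n k (suc p))
  p<j : p < j
  p<j = subst (p <_) e (s≤s (m≤n+m p k))

factorA-short : ∀ {j k} → k ≤ j → factorA j k ≡ prefixA j k
factorA-short {j} {k} k≤j with k <ᵇ suc j in f
... | true  = refl
... | false = ⊥-elim (subst T f (<⇒<ᵇ (s≤s k≤j)))

factorA-long : ∀ j → factorA j (suc j) ≡ prefixA j (j ∸ 1) ∷ʳ neg 1
factorA-long j with suc j <ᵇ suc j in f
... | false = refl
... | true  = ⊥-elim (n≮n (suc j) (<ᵇ⇒< (suc j) (suc j) (subst T (sym f) tt)))

factorA-insAt : ∀ j k → k ≤ 2 + j →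
  map (evalA (factorA (suc j) k)) (range (3 + j)) ≡ insAt (2 + j ∸ k) (3 + j) (swap^ k (range (2 + j)))
factorA-insAt j k k≤ with k ≤? suc j
... | yes k≤1+j rewrite factorA-short k≤1+j | +-∸-assoc 1 k≤1+j =
  prefixA-insAt (suc j) k (suc j ∸ k) (m+[n∸m]≡n k≤1+j)
... | no k≰1+j with ≤-antisym k≤ (≰⇒> k≰1+j)
...   | refl rewrite n∸n≡0 j | factorA-long (suc j) = begin
  map (evalA (prefixA (suc j) j ∷ʳ neg 1)) (range (3 + j))
    ≡⟨ map-cong (evalA-++ (prefixA (suc j) j) (neg 1 ∷ [])) (range (3 + j)) ⟩
  map (G ∘ s 2 ∘ s 1) (range (3 + j))
    ≡⟨ map-∘s-range (G ∘ s 2) 0 (3 + j) (s≤s (s≤s z≤n)) ⟩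
  swapAt 0 (map (G ∘ s 2) (range (3 + j)))
    ≡⟨ cong (swapAt 0) (map-∘s-range G 1 (3 + j) (s≤s (s≤s (s≤s z≤n)))) ⟩
  swapAt 0 (swapAt 1 (map G (range (3 + j))))
    ≡⟨ cong (swapAt 0 ∘ swapAt 1) (prefixA-insAt (suc j) j 1 (+-comm j 1)) ⟩
  swapAt 0 (swapAt 1 (insAt 2 (3 + j) u))
    ≡⟨ cong (swapAt 0) (swapAt-insAt 1 (3 + j) u (subst (2 ≤_) (sym (length-swap^-range j (2 + j))) (s≤s (s≤s z≤n)))) ⟩
  swapAt 0 (insAt 1 (3 + j) u)
    ≡⟨ swapAt-insAt 0 (3 + j) u (subst (1 ≤_) (sym (length-swap^-range j (2 + j))) (s≤s z≤n)) ⟩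
  insAt 0 (3 + j) u
    -- a_1⁻¹ = s_2 s_1 carries the maximum past two entries without exchanging them, so only the `j`
    -- letters before it twist. The two further swaps in `swap^ (2 + j)` cancel, and the exceptional
    -- choice obeys the same formula as the others.
    ≡⟨ cong (3 + j ∷_) (swapAt-involutive 0 u) ⟨
  insAt 0 (3 + j) (swap^ (2 + j) (range (2 + j))) ∎
  where
  open ≡-Reasoning
  G = evalA (prefixA (suc j) j)
  u = swap^ j (range (2 + j))

act-fixes : ∀ x l → 2 + index l < x → 2 < x → act l x ≡ x
act-fixes x (pos i) i< 2<x = trans (cong (s 1) (s-fixes (suc i) x i<)) (s-fixes 1 x 2<x)
act-fixes x (neg i) i< 2<x = trans (cong (s (suc i)) (s-fixes 1 x 2<x)) (s-fixes (suc i) x i<)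

prefixA-fixes : ∀ x i k → 1 ≤ i → 2 + i < x → All (λ l → act l x ≡ x) (prefixA i k)
prefixA-fixes x i k 1≤i i< = All.map⁺ (All.tabulate (λ {r} _ →
  act-fixes x (pos (i ∸ r)) (≤-trans (s≤s (s≤s (s≤s (m∸n≤m i r)))) i<) (≤-trans (s≤s (s≤s (≤-trans 1≤i (n≤1+n i)))) i<)))

factorA-fixes : ∀ x i k → 1 ≤ i → 2 + i < x → All (λ l → act l x ≡ x) (factorA i k)
factorA-fixes x i k 1≤i i< with k <ᵇ suc i
... | true  = prefixA-fixes x i k 1≤i i<
... | false = All.++⁺ (prefixA-fixes x i (i ∸ 1) 1≤i i<)
  (act-fixes x (neg 1) 3<x (<-trans (n<1+n 2) 3<x) ∷ [])
  where
  3<x : 3 < x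
  3<x = ≤-trans (s≤s (s≤s (s≤s 1≤i))) i<

permA-∷ʳ : ∀ {r ks k} → Tuple (suc ∘ suc) r ks → k ≤ 2 + r →
           permA (2 + r) (ks ∷ʳ k) ≡ ins k (3 + r) (swap^ k (permA (suc r) ks))
permA-∷ʳ {r} {ks} {k} τ k≤ = begin
  map (evalA (wordA (ks ∷ʳ k))) (range (3 + r))
    ≡⟨ cong (λ ls → map (evalA ls) (range (3 + r))) (indexed-Tuple k factorA τ) ⟩
  map (evalA (wordA ks ++ factorA (suc r) k)) (range (3 + r))
    ≡⟨ map-cong (evalA-++ (wordA ks) (factorA (suc r) k)) (range (3 + r)) ⟩
  map (E ∘ evalA (factorA (suc r) k)) (range (3 + r))
    ≡⟨ map-∘ (range (3 + r)) ⟩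
  map E (map (evalA (factorA (suc r) k)) (range (3 + r)))
    ≡⟨ cong (map E) (factorA-insAt r k k≤) ⟩
  map E (insAt p (3 + r) (swap^ k (range (2 + r))))
    ≡⟨ map-insAt E p (3 + r) (swap^ k (range (2 + r))) ⟩
  insAt p (E (3 + r)) (map E (swap^ k (range (2 + r))))
    ≡⟨ cong₂ (insAt p) E-fixes (map-swap^ E k (range (2 + r))) ⟩
  insAt p (3 + r) (swap^ k (permA (suc r) ks))
    ≡⟨ cong (λ l → insAt (l ∸ k) (3 + r) (swap^ k (permA (suc r) ks)))
         (trans (↭-length (swap^-↭ k (permA (suc r) ks))) (length-oneLine (2 + r) E)) ⟨
  ins k (3 + r) (swap^ k (permA (suc r) ks)) ∎
  where
  open ≡-Reasoning
  E = evalA (wordA ks)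
  p = 2 + r ∸ k
  E-fixes : E (3 + r) ≡ 3 + r
  E-fixes = evalWord-fixes (All.map⁺ (All-indexed 1 ks factorA (λ i k 1≤i i< → factorA-fixes (3 + r) i k 1≤i (s≤s (s≤s i<)))
    (s≤s (≤-reflexive (length-Tuple τ)))))

-- Inversions and parity

+-exchange : ∀ a b c → a + (b + c) ≡ b + (a + c)
+-exchange a b c = trans (sym (+-assoc a b c)) (trans (cong (_+ c) (+-comm a b)) (+-assoc b a c))

bit : Bool → ℕ
bit b = if b then 1 else 0

count-∷ : ∀ {A : Set} (p : A → Bool) x xs → count p (x ∷ xs) ≡ bit (p x) + count p xs
count-∷ p x xs with p x
... | true  = refl
... | false = refl

count-↭ : ∀ {A : Set} (p : A → Bool) {xs ys} → xs ↭ ys → count p xs ≡ count p ys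
count-↭ p Perm.refl = refl
count-↭ p (Perm.prep {xs} {ys} x e) =
  trans (count-∷ p x xs) (trans (cong (bit (p x) +_) (count-↭ p e)) (sym (count-∷ p x ys)))
count-↭ p (Perm.swap {xs} {ys} x y e) = begin
  count p (x ∷ y ∷ xs)                    ≡⟨ count-∷∷ x y xs ⟩
  bit (p x) + (bit (p y) + count p xs)    ≡⟨ cong (λ c → bit (p x) + (bit (p y) + c)) (count-↭ p e) ⟩
  bit (p x) + (bit (p y) + count p ys)    ≡⟨ +-exchange (bit (p x)) (bit (p y)) (count p ys) ⟩
  bit (p y) + (bit (p x) + count p ys)    ≡⟨ count-∷∷ y x ys ⟨
  count p (y ∷ x ∷ ys)                    ∎
  where
  open ≡-Reasoning
  count-∷∷ : ∀ x y xs → count p (x ∷ y ∷ xs) ≡ bit (p x) + (bit (p y) + count p xs)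
  count-∷∷ x y xs = trans (count-∷ p x (y ∷ xs)) (cong (bit (p x) +_) (count-∷ p y xs))
count-↭ p (Perm.trans e f) = trans (count-↭ p e) (count-↭ p f)

<ᵇ-true : ∀ {m n} → m < n → (m <ᵇ n) ≡ true
<ᵇ-true {m} {n} m<n with m <ᵇ n in e
... | true  = refl
... | false = ⊥-elim (subst T e (<⇒<ᵇ m<n))

<ᵇ-false : ∀ {m n} → n ≤ m → (m <ᵇ n) ≡ false
<ᵇ-false {m} {n} n≤m with m <ᵇ n in e
... | false = refl
... | true  = ⊥-elim (<⇒≱ (<ᵇ⇒< m n (subst T (sym e) tt)) n≤m)

count-all : ∀ {A : Set} (p : A → Bool) {xs} → All (λ x → p x ≡ true) xs → count p xs ≡ length xs
count-all p []       = refl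
count-all p {x ∷ xs} (px ∷ a) = trans (count-∷ p x xs) (cong₂ (λ b → bit b +_) px (count-all p a))

ℓS-insAt : ∀ p {m u} → All (_< m) u → ℓS (insAt p m u) ≡ (length u ∸ p) + ℓS u
ℓS-insAt zero    {m} {u} a = cong (_+ ℓS u) (count-all (_<ᵇ m) (All.map <ᵇ-true a))
ℓS-insAt (suc p) []        = refl
ℓS-insAt (suc p) {m} {x ∷ u} (x<m ∷ a) = begin
  count (_<ᵇ x) (insAt p m u) + ℓS (insAt p m u)
    ≡⟨ cong₂ _+_ (trans (count-↭ (_<ᵇ x) (insAt-↭ p m u))
         (trans (count-∷ (_<ᵇ x) m u) (cong (λ b → bit b + count (_<ᵇ x) u) (<ᵇ-false (<⇒≤ x<m)))))
         (ℓS-insAt p a) ⟩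
  c + ((length u ∸ p) + ℓS u)   ≡⟨ +-assoc c (length u ∸ p) (ℓS u) ⟨
  c + (length u ∸ p) + ℓS u     ≡⟨ cong (_+ ℓS u) (+-comm c (length u ∸ p)) ⟩
  (length u ∸ p) + c + ℓS u     ≡⟨ +-assoc (length u ∸ p) c (ℓS u) ⟩
  (length u ∸ p) + (c + ℓS u)   ∎
  where
  open ≡-Reasoning
  c = count (_<ᵇ x) u

ℓS-ins : ∀ {k m u} → k ≤ length u → All (_< m) u → ℓS (ins k m u) ≡ k + ℓS u
ℓS-ins {k} {m} {u} k≤ a = trans (ℓS-insAt (length u ∸ k) a) (cong (_+ ℓS u) (m∸[m∸n]≡n k≤))

even : ℕ → Bool
even zero    = true
even (suc n) = not (even n)

%2≡ᵇ0 : ∀ n → (n % 2 ≡ᵇ 0) ≡ even n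
%2≡ᵇ0 zero          = refl
%2≡ᵇ0 (suc zero)    = refl
%2≡ᵇ0 (suc (suc n)) = trans (%2≡ᵇ0 n) (sym (not-involutive (even n)))

even-+-not : ∀ a {b c} → even b ≡ not (even c) → even (a + b) ≡ not (even (a + c))
even-+-not zero    e = e
even-+-not (suc a) e = cong not (even-+-not a e)

-- Apart from the comparison of the two exchanged entries all inversions are merely permuted, and as
-- these entries are distinct that one comparison is reversed.
swapAt-parity : ∀ i w → Unique w → 2 + i ≤ length w → even (ℓS (swapAt i w)) ≡ not (even (ℓS w))
swapAt-parity zero (x ∷ []) _ (s≤s ())
swapAt-parity zero (x ∷ y ∷ w) ((x≢y ∷ _) ∷ _) _
  rewrite count-∷ (_<ᵇ x) y w | count-∷ (_<ᵇ y) x w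
  with <-cmp x y
... | tri< x<y _ _ rewrite <ᵇ-true x<y | <ᵇ-false (<⇒≤ x<y) =
  cong (not ∘ even) (+-exchange (count (_<ᵇ y) w) (count (_<ᵇ x) w) (ℓS w))
... | tri≈ _ x≡y _ = ⊥-elim (x≢y x≡y)
... | tri> _ _ y<x rewrite <ᵇ-true y<x | <ᵇ-false (<⇒≤ y<x) =
  trans (cong even (+-exchange (count (_<ᵇ y) w) (count (_<ᵇ x) w) (ℓS w))) (sym (not-involutive _))
swapAt-parity (suc i) (x ∷ w) (_ ∷ u) (s≤s i<)
  rewrite count-↭ (_<ᵇ x) (swapAt-↭ i w) = even-+-not (count (_<ᵇ x) w) (swapAt-parity i w u i<)

swap^-parity : ∀ k u → Unique u → 2 ≤ length u → even (k + ℓS (swap^ k u)) ≡ even (ℓS u)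
swap^-parity zero    u uu 2≤ = refl
swap^-parity (suc k) u uu 2≤ = trans
  (cong not (even-+-not k (swapAt-parity 0 (swap^ k u) (unique-resp-↭ (↭-sym (swap^-↭ k u)) uu)
    (subst (2 ≤_) (sym (↭-length (swap^-↭ k u))) 2≤))))
  (trans (not-involutive _) (swap^-parity k u uu 2≤))

EvenPerm : List ℕ → Set
EvenPerm w = T (ℓS w % 2 ≡ᵇ 0)

-- The insertion creates k inversions and the twist flips the parity k times; the two effects
-- cancel.
even-ins : ∀ {r k u} → u ↭ range (2 + r) → k ≤ 2 + r →
           (ℓS (ins k (3 + r) (swap^ k u)) % 2 ≡ᵇ 0) ≡ (ℓS u % 2 ≡ᵇ 0)
even-ins {r} {k} {u} u↭ k≤ = begin
  (ℓS (ins k (3 + r) (swap^ k u)) % 2 ≡ᵇ 0)  ≡⟨ %2≡ᵇ0 (ℓS (ins k (3 + r) (swap^ k u))) ⟩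
  even (ℓS (ins k (3 + r) (swap^ k u)))
    ≡⟨ cong even (ℓS-ins (≤-trans k≤ (≤-reflexive (sym (trans (↭-length v↭) (length-range (2 + r)))))) (all-< v↭)) ⟩
  even (k + ℓS (swap^ k u))
    ≡⟨ swap^-parity k u (unique-resp-↭ (↭-sym u↭) (unique-range (2 + r)))
         (≤-trans (s≤s (s≤s z≤n)) (≤-reflexive (sym (trans (↭-length u↭) (length-range (2 + r)))))) ⟩
  even (ℓS u)                                ≡⟨ %2≡ᵇ0 (ℓS u) ⟨
  (ℓS u % 2 ≡ᵇ 0)                            ∎
  where
  open ≡-Reasoning
  v↭ : swap^ k u ↭ range (2 + r)
  v↭ = ↭-trans (swap^-↭ k u) u↭

↭-pair-inv : ∀ {x y : ℕ} {w} → w ↭ x ∷ y ∷ [] → w ≡ x ∷ y ∷ [] ⊎ w ≡ y ∷ x ∷ []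
↭-pair-inv {x} {y} {w} w↭ with ∈-∃++ (∈-resp-↭ (↭-sym w↭) (here refl))
... | []         , v , refl = inj₁ (cong (x ∷_) (↭-singleton-inv (drop-mid [] [] w↭)))
... | z ∷ u , v , refl with ↭-singleton-inv (drop-mid (z ∷ u) [] w↭)
... | e with u | v | e
... | [] | [] | refl = inj₂ refl

even-pair : ∀ {w} → w ↭ 1 ∷ 2 ∷ [] → EvenPerm w → w ≡ 1 ∷ 2 ∷ []
even-pair w↭ good with ↭-pair-inv w↭
... | inj₁ e    = e
... | inj₂ refl = ⊥-elim good

-- Factorisations enumerate the symmetric and the alternating group

module S = Enumeration suc (λ _ → refl) (λ _ u → u) (λ _ _ → ↭-refl) (λ _ _ → refl)
  (permS ∘ suc) (λ _ → ⊤) (λ _ _ _ → tt) (λ _ _ _ → tt)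
  (↭-refl , tt) (λ w↭ _ → ↭-singleton-inv w↭) permS-∷ʳ

-- The induction starts from words on two letters, of which [2,1] must be excluded; this is where
-- `Good` cuts the symmetric group down to the even permutations.
module A = Enumeration (suc ∘ suc) (λ _ → refl) swap^ swap^-↭ swap^-involutive
  (permA ∘ suc) EvenPerm
  (λ {r} u↭ k≤ → subst T (sym (even-ins {r} u↭ k≤))) (λ {r} u↭ k≤ → subst T (even-ins {r} u↭ k≤))
  (↭-refl , tt) even-pair permA-∷ʳ

Sym-↭ : ∀ r → Sym (suc r) ↭ map (permS (suc r)) (tuplesS (suc r))
Sym-↭ r = S.enumerates r (unique-Sym (suc r)) (λ w∈ → ∈-Sym⁻ w∈ , tt) (∈-Sym⁺ ∘ proj₁)

∈-Alt⁻ : ∀ {n w} → w ∈ Alt n → w ↭ range (suc n) × EvenPerm w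
∈-Alt⁻ w∈ with ∈-filter⁻ (λ w → T? (ℓS w % 2 ≡ᵇ 0)) w∈
... | w∈Sym , e = ∈-Sym⁻ w∈Sym , e

Alt-↭ : ∀ r → Alt (suc r) ↭ map (permA (suc r)) (tuplesA (suc r))
Alt-↭ r = A.enumerates r (Unique.filter⁺ _ (unique-Sym (2 + r))) ∈-Alt⁻
  (λ (w↭ , e) → ∈-filter⁺ (λ w → T? (ℓS w % 2 ≡ᵇ 0)) (∈-Sym⁺ w↭) e)

delS-permS : ∀ {r ks} → Tuple suc r ks → delS (suc r) (permS (suc r) ks) ≡ delCountS ks
delS-permS τ = cong (maybe delCountS 0) (S.findFirst-perm τ)

factWordA-permA : ∀ {r ks} → Tuple (suc ∘ suc) r ks → factWordA (suc r) (permA (suc r) ks) ≡ wordA ks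
factWordA-permA τ = cong (maybe wordA []) (A.findFirst-perm τ)

-- Length in the alternating group

-- With σ = (P reversed) ++ w, this is Σ_j min(#{i < j : σ(i) > σ(j)}, j ∸ 2) over the positions j of the entries in w.
lenA : List ℕ → List ℕ → ℕ
lenA P []      = 0
lenA P (b ∷ w) = count (b <ᵇ_) P ⊓ (length P ∸ 1) + lenA (b ∷ P) w

lenA-↭ : ∀ {P Q} w → P ↭ Q → lenA P w ≡ lenA Q w
lenA-↭ []      _   = refl
lenA-↭ (b ∷ w) P↭Q = cong₂ _+_
  (cong₂ (λ c l → c ⊓ (l ∸ 1)) (count-↭ (b <ᵇ_) P↭Q) (↭-length P↭Q)) (lenA-↭ w (↭-prep b P↭Q))

lenA-pair : ∀ x y w → lenA [] (x ∷ y ∷ w) ≡ lenA (y ∷ x ∷ []) w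
lenA-pair x y w = cong (_+ lenA (y ∷ x ∷ []) w) (⊓-zeroʳ (count (y <ᵇ_) (x ∷ [])))

-- The first two entries are capped at 0, and the later terms see only the multiset of letters
-- before them. This removes the twist from every computation of length.
lenA-swapAt-zero : ∀ w → lenA [] (swapAt 0 w) ≡ lenA [] w
lenA-swapAt-zero []          = refl
lenA-swapAt-zero (x ∷ [])    = refl
lenA-swapAt-zero (x ∷ y ∷ w) = trans (lenA-pair y x w)
  (trans (lenA-↭ w (Perm.swap x y ↭-refl)) (sym (lenA-pair x y w)))

lenA-swap^ : ∀ k w → lenA [] (swap^ k w) ≡ lenA [] w
lenA-swap^ zero    w = refl
lenA-swap^ (suc k) w = trans (lenA-swapAt-zero (swap^ k w)) (lenA-swap^ k w)

-- A maximum in the prefix raises both the count and the cap of each later letter by one, hence also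
-- their minimum. The letter `z` keeps the prefix nonempty; otherwise the truncated cap would stay
-- at 0 for the next letter.
lenA-max-prefix : ∀ {m} z P {w} → All (_< m) w → lenA (m ∷ z ∷ P) w ≡ length w + lenA (z ∷ P) w
lenA-max-prefix z P [] = refl
lenA-max-prefix {m} z P {b ∷ w} (b<m ∷ a) = begin
  count (b <ᵇ_) (m ∷ z ∷ P) ⊓ suc (length P) + lenA (b ∷ m ∷ z ∷ P) w
    ≡⟨ cong₂ (λ c → c ⊓ suc (length P) +_)
         (trans (count-∷ (b <ᵇ_) m (z ∷ P)) (cong (λ t → bit t + c) (<ᵇ-true b<m)))
         (trans (lenA-↭ w (Perm.swap b m ↭-refl)) (lenA-max-prefix b (z ∷ P) a)) ⟩
  suc (c ⊓ length P + (length w + lenA (b ∷ z ∷ P) w))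
    ≡⟨ cong suc (+-exchange (c ⊓ length P) (length w) _) ⟩
  suc (length w + (c ⊓ length P + lenA (b ∷ z ∷ P) w)) ∎
  where
  open ≡-Reasoning
  c = count (b <ᵇ_) (z ∷ P)

count-none : ∀ {A : Set} (p : A → Bool) {xs} → All (λ x → p x ≡ false) xs → count p xs ≡ 0
count-none p [] = refl
count-none p {x ∷ xs} (px ∷ a) = trans (count-∷ p x xs) (cong₂ (λ b → bit b +_) px (count-none p a))

lenA-insAt : ∀ p {m} z P {u} → All (_< m) (z ∷ P) → All (_< m) u →
             lenA (z ∷ P) (insAt p m u) ≡ (length u ∸ p) + lenA (z ∷ P) u
lenA-insAt zero {m} z P {u} aP au rewrite count-none (m <ᵇ_) (All.map (<ᵇ-false ∘ <⇒≤) aP) = lenA-max-prefix z P au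
lenA-insAt (suc p) {m} z P {[]} aP au rewrite count-none (m <ᵇ_) (All.map (<ᵇ-false ∘ <⇒≤) aP) = refl
lenA-insAt (suc p) {m} z P {x ∷ u} aP (x< ∷ au) =
  trans (cong (c +_) (lenA-insAt p x (z ∷ P) (x< ∷ aP) au)) (+-exchange c (length u ∸ p) _)
  where
  c = count (x <ᵇ_) (z ∷ P) ⊓ length P

lenA-ins : ∀ {k m} x u → k ≤ length u → All (_< m) (x ∷ u) → lenA [] (ins k m (x ∷ u)) ≡ k + lenA [] (x ∷ u)
lenA-ins {k} {m} x u k≤ (x< ∷ au) = begin
  lenA [] (ins k m (x ∷ u))      ≡⟨ cong (lenA []) (ins-∷ m x u k≤) ⟩
  lenA (x ∷ []) (ins k m u)      ≡⟨ lenA-insAt (length u ∸ k) x [] (x< ∷ []) au ⟩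
  (length u ∸ (length u ∸ k)) + lenA (x ∷ []) u ≡⟨ cong (_+ lenA (x ∷ []) u) (m∸[m∸n]≡n k≤) ⟩
  k + lenA (x ∷ []) u            ∎
  where open ≡-Reasoning

-- In front, the maximum pushes x only into the second place, where the cap is still 0; so x gains
-- nothing and the increment is the same as for the second place.
lenA-ins-front : ∀ {m} x u → All (_< m) (x ∷ u) → lenA [] (m ∷ x ∷ u) ≡ length u + lenA [] (x ∷ u)
lenA-ins-front {m} x u (_ ∷ au) = trans (lenA-pair m x u)
  (trans (lenA-↭ u (Perm.swap x m ↭-refl)) (lenA-max-prefix x [] au))

length-prefixA : ∀ j k → length (prefixA j k) ≡ k
length-prefixA j k = trans (length-map _ (upTo k)) (length-upTo k)

length-factorA-short : ∀ {j k} → k ≤ j → length (factorA j k) ≡ k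
length-factorA-short {j} {k} k≤j = trans (cong length (factorA-short k≤j)) (length-prefixA j k)

length-factorA-long : ∀ j → length (factorA (suc j) (2 + j)) ≡ suc j
length-factorA-long j = trans (cong length (factorA-long (suc j)))
  (trans (length-++ (prefixA (suc j) j)) (trans (+-comm _ 1) (cong suc (length-prefixA (suc j) j))))

length-wordA-∷ʳ : ∀ {r ks} k → Tuple (suc ∘ suc) r ks →
                  length (wordA (ks ∷ʳ k)) ≡ length (factorA (suc r) k) + length (wordA ks)
length-wordA-∷ʳ {r} {ks} k τ = trans (cong length (indexed-Tuple k factorA τ))
  (trans (length-++ (wordA ks)) (+-comm (length (wordA ks)) _))

lenA-ins-factorA : ∀ {r k u} → u ↭ range (2 + r) → k ≤ 2 + r →
                   lenA [] (ins k (3 + r) u) ≡ length (factorA (suc r) k) + lenA [] u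
lenA-ins-factorA {r} {k} {[]} u↭ k≤ with ↭-length u↭
... | ()
lenA-ins-factorA {r} {k} {x ∷ u} u↭ k≤ with k ≤? suc r
... | yes k≤1+r rewrite length-factorA-short k≤1+r =
  lenA-ins x u (subst (k ≤_) (sym (suc-injective (trans (↭-length u↭) (length-range (2 + r))))) k≤1+r) (all-< u↭)
... | no k≰1+r with ≤-antisym k≤ (≰⇒> k≰1+r)
...   | refl rewrite length-factorA-long r = begin
  lenA [] (ins (2 + r) (3 + r) (x ∷ u))        ≡⟨ cong (λ l → lenA [] (ins l (3 + r) (x ∷ u))) len ⟨
  lenA [] (ins (length (x ∷ u)) (3 + r) (x ∷ u)) ≡⟨ cong (lenA []) (ins-length (3 + r) (x ∷ u)) ⟩
  lenA [] (3 + r ∷ x ∷ u)                      ≡⟨ lenA-ins-front x u (all-< u↭) ⟩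
  length u + lenA [] (x ∷ u)                   ≡⟨ cong (_+ lenA [] (x ∷ u)) (suc-injective len) ⟩
  suc r + lenA [] (x ∷ u)                      ∎
  where
  open ≡-Reasoning
  len : length (x ∷ u) ≡ 2 + r
  len = trans (↭-length u↭) (length-range (2 + r))

lenA-permA : ∀ {r ks} → Tuple (suc ∘ suc) r ks → lenA [] (permA (suc r) ks) ≡ length (wordA ks)
lenA-permA [] = refl
lenA-permA (snoc {r} {ks} {k} τ k<) = begin
  lenA [] (permA (2 + r) (ks ∷ʳ k))
    ≡⟨ cong (lenA []) (permA-∷ʳ τ (≤-pred k<)) ⟩
  lenA [] (ins k (3 + r) (swap^ k u))
    ≡⟨ lenA-ins-factorA (↭-trans (swap^-↭ k u) (proj₁ (A.perm-valid τ))) (≤-pred k<) ⟩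
  length (factorA (suc r) k) + lenA [] (swap^ k u)
    ≡⟨ cong (length (factorA (suc r) k) +_) (trans (lenA-swap^ k u) (lenA-permA τ)) ⟩
  length (factorA (suc r) k) + length (wordA ks)
    ≡⟨ length-wordA-∷ʳ k τ ⟨
  length (wordA (ks ∷ʳ k)) ∎
  where
  open ≡-Reasoning
  u = permA (suc r) ks

-- Evenness provides the tuple. On an odd word the search behind `ℓA` fails and returns length 0,
-- which `lenA` need not do.
ℓA≡lenA : ∀ r {w} → w ↭ range (2 + r) → EvenPerm w → ℓA (suc r) w ≡ lenA [] w
ℓA≡lenA r w↭ e with A.perm-surjective r w↭ e
... | ks , τ , refl = trans (cong length (factWordA-permA τ)) (sym (lenA-permA τ))

-- Reverse major indices

map-app-range : ∀ w → map (app w) (range (length w)) ≡ w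
map-app-range []      = refl
map-app-range (x ∷ w) = cong (x ∷_) (begin
  map (app (x ∷ w)) (map suc (applyUpTo suc (length w)))
    ≡⟨ cong (map (app (x ∷ w)) ∘ map suc) (map-upTo suc (length w)) ⟨
  map (app (x ∷ w)) (map suc (range (length w)))
    ≡⟨ map-∘ (range (length w)) ⟨
  map (app (x ∷ w) ∘ suc) (range (length w))
    ≡⟨ map-∘ (upTo (length w)) ⟨
  map (app (x ∷ w) ∘ suc ∘ suc) (upTo (length w))
    ≡⟨ map-∘ (upTo (length w)) ⟩
  map (app w) (range (length w))
    ≡⟨ map-app-range w ⟩
  w ∎)
  where open ≡-Reasoning

mulA-swapAt : ∀ {r i σ} → length σ ≡ 2 + r → i < r → mulA (suc r) σ (suc i) ≡ swapAt (suc i) (swapAt 0 σ)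
mulA-swapAt {r} {i} {σ} len i<r = begin
  map (app σ ∘ s 1 ∘ s (2 + i)) (range (2 + r))
    ≡⟨ map-∘s-range (app σ ∘ s 1) (suc i) (2 + r) (s≤s (s≤s i<r)) ⟩
  swapAt (suc i) (map (app σ ∘ s 1) (range (2 + r)))
    ≡⟨ cong (swapAt (suc i)) (map-∘s-range (app σ) 0 (2 + r) (s≤s (s≤s z≤n))) ⟩
  swapAt (suc i) (swapAt 0 (map (app σ) (range (2 + r))))
    ≡⟨ cong (λ l → swapAt (suc i) (swapAt 0 (map (app σ) (range l)))) len ⟨
  swapAt (suc i) (swapAt 0 (map (app σ) (range (length σ))))
    ≡⟨ cong (swapAt (suc i) ∘ swapAt 0) (map-app-range σ) ⟩
  swapAt (suc i) (swapAt 0 σ) ∎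
  where open ≡-Reasoning

swapAt²-even : ∀ i w → Unique w → 3 + i ≤ length w → EvenPerm w → EvenPerm (swapAt (suc i) (swapAt 0 w))
swapAt²-even i w u i<w = subst T (begin
  (ℓS w % 2 ≡ᵇ 0)                       ≡⟨ %2≡ᵇ0 (ℓS w) ⟩
  even (ℓS w)                           ≡⟨ not-involutive _ ⟨
  not (not (even (ℓS w)))               ≡⟨ cong not (swapAt-parity 0 w u (≤-trans (s≤s (s≤s z≤n)) i<w)) ⟨
  not (even (ℓS (swapAt 0 w)))
    ≡⟨ swapAt-parity (suc i) (swapAt 0 w) (unique-resp-↭ (↭-sym (swapAt-↭ 0 w)) u)
         (subst (3 + i ≤_) (sym (↭-length (swapAt-↭ 0 w))) i<w) ⟨
  even (ℓS (swapAt (suc i) (swapAt 0 w))) ≡⟨ %2≡ᵇ0 (ℓS (swapAt (suc i) (swapAt 0 w))) ⟨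
  (ℓS (swapAt (suc i) (swapAt 0 w)) % 2 ≡ᵇ 0) ∎)
  where open ≡-Reasoning

-- The reverse major index of a word whose last letter read is a, where i is an A-descent
-- if b = σ(i+2) lies below a = σ(i+1) or below everything before a; p is the minimum of the letters before a.
-- For p = 0 this is the ordinary reverse major index.
rmaj : ℕ → ℕ → List ℕ → ℕ
rmaj p a []      = 0
rmaj p a (b ∷ w) = (if b <ᵇ p ⊔ a then suc (length w) else 0) + rmaj (p ⊓ a) b w

-- Only the maximum and the minimum of the two enter. This makes `rmajWord` invariant under an
-- exchange of the first two letters, as `lenA` is.
rmaj-comm : ∀ p a w → rmaj p a w ≡ rmaj a p w
rmaj-comm p a []      = refl
rmaj-comm p a (b ∷ w) = cong₂ (λ x y → (if b <ᵇ x then suc (length w) else 0) + rmaj y b w) (⊔-comm p a) (⊓-comm p a)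

sum-upTo-suc : ∀ f l → sum (map f (upTo (suc l))) ≡ f 0 + sum (map (f ∘ suc) (upTo l))
sum-upTo-suc f l = cong (λ xs → f 0 + sum xs)
  (trans (map-applyUpTo suc f l) (sym (map-applyUpTo id (f ∘ suc) l)))

rmajS-rmaj : ∀ a w → rmajS (suc (length w)) (a ∷ w) ≡ rmaj 0 a w
rmajS-rmaj a w = trans (cong sum (sym (map-∘ (upTo (length w))))) (go a w)
  where
  go : ∀ a w → sum (map (λ i → if app (a ∷ w) (2 + i) <ᵇ app (a ∷ w) (suc i) then length w ∸ i else 0) (upTo (length w)))
               ≡ rmaj 0 a w
  go a []      = refl
  go a (b ∷ w) = trans (sum-upTo-suc _ (length w)) (cong ((if b <ᵇ a then suc (length w) else 0) +_) (go b w))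

IsMin : ℕ → List ℕ → Set
IsMin p P = p ∈ P × All (p ≤_) P

IsMin-∷ : ∀ {p P} a → IsMin p P → IsMin (p ⊓ a) (a ∷ P)
IsMin-∷ {p} {P} a (p∈ , p≤) with ⊓-sel p a
... | inj₁ e = subst (_∈ a ∷ P) (sym e) (there p∈) , m⊓n≤n p a ∷ All.map (≤-trans (m⊓n≤m p a)) p≤
... | inj₂ e = here e , m⊓n≤n p a ∷ All.map (≤-trans (m⊓n≤m p a)) p≤

count-≤ : ∀ {A : Set} (p : A → Bool) xs → count p xs ≤ length xs
count-≤ p []       = z≤n
count-≤ p (x ∷ xs) rewrite count-∷ p x xs with p x
... | true  = s≤s (count-≤ p xs)
... | false = m≤n⇒m≤1+n (count-≤ p xs)

count-< : ∀ {A : Set} (p : A → Bool) {x xs} → x ∈ xs → p x ≡ false → count p xs < length xs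
count-< p {xs = y ∷ xs} (here refl) e rewrite count-∷ p y xs | e = s≤s (count-≤ p xs)
count-< p {xs = y ∷ xs} (there x∈) e rewrite count-∷ p y xs with p y
... | true  = s≤s (count-< p x∈ e)
... | false = m≤n⇒m≤1+n (count-< p x∈ e)

+-<ᵇ-cancelˡ : ∀ c m n → (c + m <ᵇ c + n) ≡ (m <ᵇ n)
+-<ᵇ-cancelˡ zero    m n = refl
+-<ᵇ-cancelˡ (suc c) m n = +-<ᵇ-cancelˡ c m n

⊔-<ᵇ : ∀ b p a → p ≤ b → a ≤ b → (b <ᵇ p ⊔ a) ≡ false
⊔-<ᵇ b p a p≤b a≤b = <ᵇ-false (⊔-lub p≤b a≤b)

-- Only the terms of a and b change: the later of the two places has a cap one higher, and the
-- smaller letter counts the larger one exactly when it comes second. What remains to be decided is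
-- whether b reaches the cap, that is, whether it lies below the whole prefix, and this is what
-- comparison with `p` detects.
lenA-swap-head : ∀ z P {p a b} w → IsMin p (z ∷ P) → a ≢ b →
  (lenA (z ∷ P) (a ∷ b ∷ w) <ᵇ lenA (z ∷ P) (b ∷ a ∷ w)) ≡ not (b <ᵇ p ⊔ a)
lenA-swap-head z P {p} {a} {b} w (p∈ , p≤) a≢b
  rewrite count-∷ (b <ᵇ_) a (z ∷ P) | count-∷ (a <ᵇ_) b (z ∷ P)
        | lenA-↭ w (Perm.swap b a (↭-refl {x = z ∷ P}))
  with <-cmp a b
... | tri≈ _ a≡b _ = ⊥-elim (a≢b a≡b)
-- The exchange loses the inversion of a and b; moving a to the higher cap wins back at most one, so
-- the length does not grow.
... | tri> _ _ b<a rewrite <ᵇ-true b<a | <ᵇ-false (<⇒≤ b<a) | <ᵇ-true (≤-trans b<a (m≤n⊔m p a)) =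
  <ᵇ-false (≤-trans (≤-reflexive (+-exchange gb (ga ⊓ suc L) X))
    (≤-trans (+-monoˡ-≤ (gb + X) ga⊓)
      (≤-reflexive (sym (+-suc (ga ⊓ L) (gb + X))))))
  where
  L = length P
  X = lenA (a ∷ b ∷ z ∷ P) w
  ga = count (a <ᵇ_) (z ∷ P)
  gb = count (b <ᵇ_) (z ∷ P) ⊓ L
  ga⊓ : ga ⊓ suc L ≤ suc (ga ⊓ L)
  ga⊓ = ⊓-monoˡ-≤ (suc L) (n≤1+n ga)
... | tri< a<b _ _ rewrite <ᵇ-true a<b | <ᵇ-false (<⇒≤ a<b) with p ≤? b
-- `p` belongs to the prefix and does not exceed b, so b stays within the lower cap; the new
-- inversion makes the length grow by one.
...   | yes p≤b rewrite ⊔-<ᵇ b p a p≤b (<⇒≤ a<b) =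
  <ᵇ-true (≤-trans (≤-reflexive (cong suc
      (trans (cong (λ g → (ga ⊓ L) + (g + X)) (trans (m≤n⇒m⊓n≡m (m≤n⇒m≤1+n gb≤L)) (sym (m≤n⇒m⊓n≡m gb≤L))))
        (+-exchange (ga ⊓ L) (gb ⊓ L) X))))
    (≤-reflexive (sym (+-suc (gb ⊓ L) ((ga ⊓ L) + X)))))
  where
  L = length P
  X = lenA (a ∷ b ∷ z ∷ P) w
  ga = count (a <ᵇ_) (z ∷ P)
  gb = count (b <ᵇ_) (z ∷ P)
  gb≤L : gb ≤ L
  gb≤L = ≤-pred (count-< (b <ᵇ_) p∈ (<ᵇ-false p≤b))
-- Every letter of the prefix exceeds b, so the lower cap costs b one, which balances the new
-- inversion. The lengths are equal, and Des_A counts equality as a descent.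
...   | no p≰b rewrite <ᵇ-true (≤-trans (≰⇒> p≰b) (m≤m⊔n p a)) =
  <ᵇ-false (≤-reflexive (trans (+-suc (gb ⊓ L) (ga ⊓ L + X))
    (trans (cong suc (+-exchange (gb ⊓ L) (ga ⊓ L) X))
    (trans (sym (+-suc (ga ⊓ L) ((gb ⊓ L) + X))) (cong (λ g → (ga ⊓ L) + (g + X)) gb⊓)))))
  where
  L = length P
  X = lenA (a ∷ b ∷ z ∷ P) w
  ga = count (a <ᵇ_) (z ∷ P)
  gb = count (b <ᵇ_) (z ∷ P)
  gb≡ : gb ≡ suc L
  gb≡ = count-all (b <ᵇ_) (All.map (λ p≤x → <ᵇ-true (≤-trans (≰⇒> p≰b) p≤x)) p≤)
  gb⊓ : suc (gb ⊓ L) ≡ gb ⊓ suc L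
  gb⊓ = trans (cong (λ g → suc (g ⊓ L)) gb≡)
    (trans (cong suc (m≥n⇒m⊓n≡n (n≤1+n L))) (sym (trans (cong (_⊓ suc L) gb≡) (⊓-idem (suc L)))))

if-not : ∀ {A : Set} b {x y : A} → (if not b then x else y) ≡ (if b then y else x)
if-not true  = refl
if-not false = refl

-- A swap behind a leaves the term of a unchanged, so it cancels from the comparison; a then joins
-- the prefix and the minimum is updated.
sum-descents : ∀ z P {p} a w → IsMin p (z ∷ P) → Unique (a ∷ w) →
  sum (map (λ i → if lenA (z ∷ P) (a ∷ w) <ᵇ lenA (z ∷ P) (swapAt i (a ∷ w)) then 0 else length w ∸ i) (upTo (length w)))
  ≡ rmaj p a w
sum-descents z P a []      min u = refl
sum-descents z P {p} a (b ∷ w) min ((a≢b ∷ _) ∷ u) = trans (sum-upTo-suc _ (length w)) (cong₂ _+_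
  (trans (cong (λ t → if t then 0 else suc (length w)) (lenA-swap-head z P w min a≢b)) (if-not (b <ᵇ p ⊔ a)))
  (trans (cong sum (map-cong (λ i → cong (λ t → if t then 0 else length w ∸ i)
      (+-<ᵇ-cancelˡ (count (a <ᵇ_) (z ∷ P) ⊓ length P) _ _)) (upTo (length w))))
    (sum-descents a (z ∷ P) b w (IsMin-∷ a min) u)))

-- Multiplication by a_i also exchanges the first two entries. As `lenA` does not see this, σ may be
-- replaced by `y ∷ x ∷ w`, and σ a_i becomes a single adjacent swap of that word behind the prefix
-- `y`; hence the order of arguments in `rmaj y x w`.
rmajA-rmaj : ∀ {r x y w} → x ∷ y ∷ w ↭ range (2 + r) → EvenPerm (x ∷ y ∷ w) →
             rmajA (suc r) (x ∷ y ∷ w) ≡ rmaj y x w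
rmajA-rmaj {r} {x} {y} {w} σ↭ e = begin
  sum (map F (range r))             ≡⟨ cong sum (map-∘ (upTo r)) ⟨
  sum (map (F ∘ suc) (upTo r))      ≡⟨ cong sum (map-cong-local (All.tabulate (λ i∈ → F-suc (∈-upTo⁻ i∈)))) ⟩
  sum (map G (upTo r))
    ≡⟨ cong (λ l → sum (map (λ i → if lenA (y ∷ []) (x ∷ w) <ᵇ lenA (y ∷ []) (swapAt i (x ∷ w)) then 0 else l ∸ i)
                            (upTo l))) len ⟨
  sum (map _ (upTo (length w)))     ≡⟨ sum-descents y [] x w (here refl , ≤-refl ∷ []) (unique-tail uτ) ⟩
  rmaj y x w                        ∎
  where
  open ≡-Reasoning
  σ = x ∷ y ∷ w
  F : ℕ → ℕ
  F i = if ℓA (suc r) σ <ᵇ ℓA (suc r) (mulA (suc r) σ i) then 0 else suc r ∸ i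
  G : ℕ → ℕ
  G i = if lenA (y ∷ []) (x ∷ w) <ᵇ lenA (y ∷ []) (swapAt i (x ∷ w)) then 0 else r ∸ i
  lenσ : length σ ≡ 2 + r
  lenσ = trans (↭-length σ↭) (length-range (2 + r))
  len : length w ≡ r
  len = suc-injective (suc-injective lenσ)
  uσ : Unique σ
  uσ = unique-resp-↭ (↭-sym σ↭) (unique-range (2 + r))
  uτ : Unique (y ∷ x ∷ w)
  uτ = unique-resp-↭ (Perm.swap x y ↭-refl) uσ
  unique-tail : ∀ {a} {u : List ℕ} → Unique (a ∷ u) → Unique u
  unique-tail (_ ∷ u) = u
  F-suc : ∀ {i} → i < r → F (suc i) ≡ G i
  F-suc {i} i<r = cong₂ (λ k l → if k <ᵇ l then 0 else r ∸ i)
    (trans (ℓA≡lenA r σ↭ e) (sym (lenA-swapAt-zero σ)))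
    (trans (cong (ℓA (suc r)) (mulA-swapAt lenσ i<r))
      (ℓA≡lenA r (↭-trans (swapAt-↭ (suc i) (swapAt 0 σ)) (↭-trans (swapAt-↭ 0 σ) σ↭))
        (swapAt²-even i σ uσ (subst (3 + i ≤_) (sym lenσ) (s≤s (s≤s i<r))) e)))

-- Statistics of the extended words

count-++ : ∀ {A : Set} (p : A → Bool) xs ys → count p (xs ++ ys) ≡ count p xs + count p ys
count-++ p []       ys = refl
count-++ p (x ∷ xs) ys = begin
  count p (x ∷ xs ++ ys)                   ≡⟨ count-∷ p x (xs ++ ys) ⟩
  bit (p x) + count p (xs ++ ys)           ≡⟨ cong (bit (p x) +_) (count-++ p xs ys) ⟩
  bit (p x) + (count p xs + count p ys)    ≡⟨ +-assoc (bit (p x)) _ _ ⟨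
  bit (p x) + count p xs + count p ys      ≡⟨ cong (_+ count p ys) (count-∷ p x xs) ⟨
  count p (x ∷ xs) + count p ys            ∎
  where open ≡-Reasoning

≡ᵇ-false : ∀ {m n} → m ≢ n → (m ≡ᵇ n) ≡ false
≡ᵇ-false {m} {n} m≢n with m ≡ᵇ n in e
... | false = refl
... | true  = ⊥-elim (m≢n (≡ᵇ⇒≡ m n (subst T (sym e) tt)))

≡ᵇ-refl : ∀ n → (n ≡ᵇ n) ≡ true
≡ᵇ-refl zero    = refl
≡ᵇ-refl (suc n) = ≡ᵇ-refl n

delCountS-∷ʳ : ∀ {r ks} k → Tuple suc r ks → delCountS (ks ∷ʳ k) ≡ bit (k ≡ᵇ suc r) + delCountS ks
delCountS-∷ʳ {r} {ks} k τ = begin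
  delCountS (ks ∷ʳ k)                       ≡⟨ cong length (indexed-Tuple k f τ) ⟩
  length (indexed 1 ks f ++ f (suc r) k)    ≡⟨ length-++ (indexed 1 ks f) ⟩
  delCountS ks + length (f (suc r) k)       ≡⟨ +-comm (delCountS ks) _ ⟩
  length (f (suc r) k) + delCountS ks       ≡⟨ cong (_+ delCountS ks) (length-if (k ≡ᵇ suc r)) ⟩
  bit (k ≡ᵇ suc r) + delCountS ks           ∎
  where
  open ≡-Reasoning
  f : ℕ → ℕ → List ℕ
  f j k = if k ≡ᵇ j then 0 ∷ [] else []
  length-if : ∀ b → length (if b then 0 ∷ [] else []) ≡ bit b
  length-if true  = refl
  length-if false = refl

delCountA : List ℕ → ℕ
delCountA ks = count (λ l → index l ≡ᵇ 1) (wordA ks)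

count-prefixA : ∀ {j k} → k < j → count (λ l → index l ≡ᵇ 1) (prefixA j k) ≡ 0
count-prefixA {j} {k} k<j = count-none _ (All.map⁺ (All.tabulate (λ {i} i∈ → ≡ᵇ-false {j ∸ i} {1} (λ j∸i≡1 →
  <⇒≢ (m+n≤o⇒m≤o∸n 2 (≤-trans (s≤s (∈-upTo⁻ i∈)) k<j)) (sym j∸i≡1)))))

count-factorA-short : ∀ {j k} → k < j → count (λ l → index l ≡ᵇ 1) (factorA j k) ≡ 0
count-factorA-short k<j rewrite factorA-short (<⇒≤ k<j) = count-prefixA k<j

count-factorA-pos : ∀ j → count (λ l → index l ≡ᵇ 1) (factorA (suc j) (suc j)) ≡ 1
count-factorA-pos j = begin
  count isOne (factorA (suc j) (suc j))           ≡⟨ cong (count isOne) (factorA-short (≤-refl {suc j})) ⟩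
  count isOne (prefixA (suc j) (suc j))           ≡⟨ cong (count isOne) (prefixA-∷ʳ (suc j) j) ⟩
  count isOne (prefixA (suc j) j ∷ʳ pos (suc j ∸ j))
    ≡⟨ cong (λ i → count isOne (prefixA (suc j) j ∷ʳ pos i)) (m+n∸n≡m 1 j) ⟩
  count isOne (prefixA (suc j) j ∷ʳ pos 1)        ≡⟨ count-++ isOne (prefixA (suc j) j) (pos 1 ∷ []) ⟩
  count isOne (prefixA (suc j) j) + 1             ≡⟨ cong (_+ 1) (count-prefixA (n<1+n j)) ⟩
  1                                               ∎
  where
  open ≡-Reasoning
  isOne : Letter → Bool
  isOne l = index l ≡ᵇ 1

count-factorA-neg : ∀ j → count (λ l → index l ≡ᵇ 1) (factorA (suc j) (2 + j)) ≡ 1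
count-factorA-neg j rewrite factorA-long (suc j)
  | count-++ (λ l → index l ≡ᵇ 1) (prefixA (suc j) j) (neg 1 ∷ [])
  | count-prefixA (n<1+n j) = refl

delCountA-∷ʳ : ∀ {r ks} k → Tuple (suc ∘ suc) r ks →
               delCountA (ks ∷ʳ k) ≡ count (λ l → index l ≡ᵇ 1) (factorA (suc r) k) + delCountA ks
delCountA-∷ʳ {r} {ks} k τ = trans (cong (count _) (indexed-Tuple k factorA τ))
  (trans (count-++ _ (wordA ks) (factorA (suc r) k)) (+-comm (delCountA ks) _))

ValidA : ℕ → List ℕ → Set
ValidA r w = w ↭ range (2 + r) × EvenPerm w

ins-validA : ∀ {r k u} → ValidA r u → k ≤ 2 + r → ValidA (suc r) (ins k (3 + r) (swap^ k u))
ins-validA {r} {k} {u} (u↭ , e) k≤ =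
  ↭-trans (ins-↭ k _ _) (↭-trans (↭-prep _ (↭-trans (swap^-↭ k u) u↭))
    (↭-trans (∷↭∷ʳ _ _) (↭-reflexive (sym (range-∷ʳ (2 + r))))))
  , subst T (sym (even-ins {r} u↭ k≤)) e

ℓA-ins : ∀ {r k u} → ValidA r u → k ≤ 2 + r →
         ℓA (2 + r) (ins k (3 + r) (swap^ k u)) ≡ length (factorA (suc r) k) + ℓA (suc r) u
ℓA-ins {r} {k} {u} v@(u↭ , e) k≤ = begin
  ℓA (2 + r) (ins k (3 + r) (swap^ k u))
    ≡⟨ ℓA≡lenA (suc r) (proj₁ (ins-validA v k≤)) (proj₂ (ins-validA v k≤)) ⟩
  lenA [] (ins k (3 + r) (swap^ k u))
    ≡⟨ lenA-ins-factorA (↭-trans (swap^-↭ k u) u↭) k≤ ⟩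
  length (factorA (suc r) k) + lenA [] (swap^ k u)
    ≡⟨ cong (length (factorA (suc r) k) +_) (trans (lenA-swap^ k u) (sym (ℓA≡lenA r u↭ e))) ⟩
  length (factorA (suc r) k) + ℓA (suc r) u ∎
  where open ≡-Reasoning

rmajWord : List ℕ → ℕ
rmajWord (x ∷ y ∷ w) = rmaj y x w
rmajWord _           = 0

rmajA≡rmajWord : ∀ {r w} → ValidA r w → rmajA (suc r) w ≡ rmajWord w
rmajA≡rmajWord {w = x ∷ y ∷ w} (w↭ , e) = rmajA-rmaj w↭ e
rmajA≡rmajWord {w = []}     (w↭ , _) with ↭-length w↭
... | ()
rmajA≡rmajWord {w = x ∷ []} (w↭ , _) with ↭-length w↭
... | ()

rmajWord-swapAt-zero : ∀ w → rmajWord (swapAt 0 w) ≡ rmajWord w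
rmajWord-swapAt-zero []          = refl
rmajWord-swapAt-zero (x ∷ [])    = refl
rmajWord-swapAt-zero (x ∷ y ∷ w) = rmaj-comm x y w

rmajWord-swap^ : ∀ k w → rmajWord (swap^ k w) ≡ rmajWord w
rmajWord-swap^ zero    w = refl
rmajWord-swap^ (suc k) w = trans (rmajWord-swapAt-zero (swap^ k w)) (rmajWord-swap^ k w)

ins-swapAt-zero : ∀ {k} m u → 2 + k ≤ length u → ins k m (swapAt 0 u) ≡ swapAt 0 (ins k m u)
ins-swapAt-zero m (x ∷ [])    (s≤s ())
ins-swapAt-zero m (x ∷ y ∷ w) (s≤s (s≤s k≤))
  rewrite +-∸-assoc 2 k≤ = refl

-- At least two letters stand before the inserted one, so the first two entries of u are still the
-- first two of the new word, where their order does not matter.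
rmajWord-ins-swap^ : ∀ j {k} m u → 2 + k ≤ length u → rmajWord (ins k m (swap^ j u)) ≡ rmajWord (ins k m u)
rmajWord-ins-swap^ zero    m u k≤ = refl
rmajWord-ins-swap^ (suc j) {k} m u k≤ = trans
  (cong rmajWord (ins-swapAt-zero m (swap^ j u) (subst (2 + k ≤_) (sym (↭-length (swap^-↭ j u))) k≤)))
  (trans (rmajWord-swapAt-zero (ins k m (swap^ j u))) (rmajWord-ins-swap^ j m u k≤))

-- With m among the first two letters, the third letter lies below m and makes 1 a descent of the
-- largest weight. Afterwards m is forgotten: the running minimum is x, just as if x and y had been
-- the first two letters.
rmajWord-insAt-zero : ∀ {m} v → All (_< m) v → 2 ≤ length v → rmajWord (insAt 0 m v) ≡ (length v ∸ 1) + rmajWord v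
rmajWord-insAt-zero (x ∷ []) _ (s≤s ())
rmajWord-insAt-zero {m} (x ∷ y ∷ w) (x< ∷ y< ∷ _) _
  rewrite <ᵇ-true (≤-trans y< (m≤n⊔m x m)) | m≤n⇒m⊓n≡m (<⇒≤ x<) = cong (suc (length w) +_) (rmaj-comm x y w)

rmajWord-insAt-one : ∀ {m} v → All (_< m) v → 2 ≤ length v → rmajWord (insAt 1 m v) ≡ (length v ∸ 1) + rmajWord v
rmajWord-insAt-one (x ∷ []) _ (s≤s ())
rmajWord-insAt-one {m} (x ∷ y ∷ w) (x< ∷ y< ∷ _) _
  rewrite <ᵇ-true (≤-trans y< (m≤m⊔n m x)) | m≥n⇒m⊓n≡n (<⇒≤ x<) = cong (suc (length w) +_) (rmaj-comm x y w)

rmajA-ins-top : ∀ {r k u} → ValidA r u → suc r ≤ k → k ≤ 2 + r →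
                rmajA (2 + r) (ins k (3 + r) (swap^ k u)) ≡ suc r + rmajA (suc r) u
rmajA-ins-top {r} {k} {u} v@(u↭ , e) 1+r≤k k≤ = begin
  rmajA (2 + r) (ins k (3 + r) (swap^ k u))   ≡⟨ rmajA≡rmajWord (ins-validA v k≤) ⟩
  rmajWord (ins k (3 + r) (swap^ k u))        ≡⟨ top ⟩
  (length (swap^ k u) ∸ 1) + rmajWord (swap^ k u)
    ≡⟨ cong₂ (λ l n → (l ∸ 1) + n) len (trans (rmajWord-swap^ k u) (sym (rmajA≡rmajWord v))) ⟩
  suc r + rmajA (suc r) u                     ∎
  where
  open ≡-Reasoning
  v↭ : swap^ k u ↭ range (2 + r)
  v↭ = ↭-trans (swap^-↭ k u) u↭
  len : length (swap^ k u) ≡ 2 + r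
  len = trans (↭-length v↭) (length-range (2 + r))
  2≤ : 2 ≤ length (swap^ k u)
  2≤ = subst (2 ≤_) (sym len) (s≤s (s≤s z≤n))
  top : rmajWord (ins k (3 + r) (swap^ k u)) ≡ (length (swap^ k u) ∸ 1) + rmajWord (swap^ k u)
  top with m≤n⇒m<n∨m≡n k≤
  ... | inj₂ refl = trans (cong (λ p → rmajWord (insAt p (3 + r) (swap^ (2 + r) u))) (trans (cong (_∸ (2 + r)) len) (n∸n≡0 r)))
          (rmajWord-insAt-zero (swap^ k u) (all-< v↭) 2≤)
  ... | inj₁ k<  with ≤-antisym (≤-pred k<) 1+r≤k
  ...   | refl = trans (cong (λ p → rmajWord (insAt p (3 + r) (swap^ (1 + r) u))) (trans (cong (_∸ (1 + r)) len) (m+n∸n≡m 1 r)))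
          (rmajWord-insAt-one (swap^ k u) (all-< v↭) 2≤)

-- Generating functions

module GeneratingFunctions {c ℓ} (R : CommutativeSemiring c ℓ) (q t : CommutativeSemiring.Carrier R) where
  private module R = CommutativeSemiring R
  open R using (Carrier; _≈_; 0#; 1#) renaming (_+_ to _⊕_; _*_ to _⊛_)
  open SetoidReasoning R.setoid
  open Solver R using (solve; _:=_; _:+_; _:*_; con)

  Σ[_] : {A : Set} → List A → (A → Carrier) → Carrier
  Σ[ xs ] f = sumOver R xs f

  pow-+ : ∀ x m n → pow R x (m + n) ≈ pow R x m ⊛ pow R x n
  pow-+ x zero    n = R.sym (R.*-identityˡ _)
  pow-+ x (suc m) n = R.trans (R.*-congˡ (pow-+ x m n)) (R.sym (R.*-assoc _ _ _))

  pow-≡ : ∀ x {m n} → m ≡ n → pow R x m ≈ pow R x n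
  pow-≡ x refl = R.refl

  Σ-cong : ∀ {A : Set} (xs : List A) {f g} → (∀ {x} → x ∈ xs → f x ≈ g x) → Σ[ xs ] f ≈ Σ[ xs ] g
  Σ-cong []       h = R.refl
  Σ-cong (x ∷ xs) h = R.+-cong (h (here refl)) (Σ-cong xs (h ∘ there))

  Σ-++ : ∀ {A : Set} (xs ys : List A) f → Σ[ xs ++ ys ] f ≈ Σ[ xs ] f ⊕ Σ[ ys ] f
  Σ-++ []       ys f = R.sym (R.+-identityˡ _)
  Σ-++ (x ∷ xs) ys f = R.trans (R.+-congˡ (Σ-++ xs ys f)) (R.sym (R.+-assoc _ _ _))

  Σ-map : ∀ {A B : Set} (g : A → B) xs f → Σ[ map g xs ] f ≡ Σ[ xs ] (f ∘ g)
  Σ-map g []       f = refl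
  Σ-map g (x ∷ xs) f = cong (f (g x) ⊕_) (Σ-map g xs f)

  Σ-concatMap : ∀ {A B : Set} (g : A → List B) xs f → Σ[ concatMap g xs ] f ≈ Σ[ xs ] (λ x → Σ[ g x ] f)
  Σ-concatMap g []       f = R.refl
  Σ-concatMap g (x ∷ xs) f = R.trans (Σ-++ (g x) (concatMap g xs) f) (R.+-congˡ (Σ-concatMap g xs f))

  Σ-*ˡ : ∀ {A : Set} (xs : List A) a f → Σ[ xs ] (λ x → a ⊛ f x) ≈ a ⊛ Σ[ xs ] f
  Σ-*ˡ []       a f = R.sym (R.zeroʳ a)
  Σ-*ˡ (x ∷ xs) a f = R.trans (R.+-congˡ (Σ-*ˡ xs a f)) (R.sym (R.distribˡ a _ _))

  Σ-*ʳ : ∀ {A : Set} (xs : List A) a f → Σ[ xs ] (λ x → f x ⊛ a) ≈ Σ[ xs ] f ⊛ a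
  Σ-*ʳ []       a f = R.sym (R.zeroˡ a)
  Σ-*ʳ (x ∷ xs) a f = R.trans (R.+-congˡ (Σ-*ʳ xs a f)) (R.sym (R.distribʳ a _ _))

  Σ-↭ : ∀ {A : Set} {xs ys : List A} f → xs ↭ ys → Σ[ xs ] f ≈ Σ[ ys ] f
  Σ-↭ f Perm.refl        = R.refl
  Σ-↭ f (Perm.prep x e)  = R.+-congˡ (Σ-↭ f e)
  Σ-↭ f (Perm.swap x y e) = R.trans (R.sym (R.+-assoc _ _ _))
    (R.trans (R.+-cong (R.+-comm _ _) (Σ-↭ f e)) (R.+-assoc _ _ _))
  Σ-↭ f (Perm.trans e e′) = R.trans (Σ-↭ f e) (Σ-↭ f e′)

  Σ-upTo-∷ʳ : ∀ n f → Σ[ upTo (suc n) ] f ≈ Σ[ upTo n ] f ⊕ f n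
  Σ-upTo-∷ʳ n f = begin
    Σ[ upTo (suc n) ] f            ≡⟨ cong (λ xs → Σ[ xs ] f) (upTo-∷ʳ n) ⟨
    Σ[ upTo n ∷ʳ n ] f             ≈⟨ Σ-++ (upTo n) (n ∷ []) f ⟩
    Σ[ upTo n ] f ⊕ (f n ⊕ 0#)     ≈⟨ R.+-congˡ (R.+-identityʳ (f n)) ⟩
    Σ[ upTo n ] f ⊕ f n            ∎

  qint-∷ : ∀ n → qint R q (suc n) ≈ 1# ⊕ q ⊛ qint R q n
  qint-∷ n = R.+-congˡ (begin
    Σ[ applyUpTo suc n ] (pow R q)       ≡⟨ cong (λ xs → Σ[ xs ] (pow R q)) (map-upTo suc n) ⟨
    Σ[ map suc (upTo n) ] (pow R q)      ≡⟨ Σ-map suc (upTo n) (pow R q) ⟩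
    Σ[ upTo n ] (λ i → q ⊛ pow R q i)    ≈⟨ Σ-*ˡ (upTo n) q (pow R q) ⟩
    q ⊛ qint R q n                       ∎)

  Σ-pow-+ : ∀ {f : ℕ → ℕ} n a → (∀ {k} → k < n → f k ≡ k + a) →
            Σ[ upTo n ] (λ k → pow R q (f k)) ≈ pow R q a ⊛ qint R q n
  Σ-pow-+ {f} n a h = begin
    Σ[ upTo n ] (λ k → pow R q (f k))
      ≈⟨ Σ-cong (upTo n) (λ {k} k∈ → R.trans (pow-≡ q (h (∈-upTo⁻ k∈))) (R.trans (pow-+ q k a) (R.*-comm _ _))) ⟩
    Σ[ upTo n ] (λ k → pow R q a ⊛ pow R q k)
      ≈⟨ Σ-*ˡ (upTo n) (pow R q a) (pow R q) ⟩
    pow R q a ⊛ qint R q n ∎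

  -- Inserting m right before b adds 1 + length w if b was no descent, and 0 if it was; in the latter
  -- case every later insertion gains one more from b.  So the increments are 0, …, 1 + length w.
  rmaj-insertion : ∀ {m} p a w → p < m → a < m → All (_< m) w →
    Σ[ upTo (suc (length w)) ] (λ k → pow R q (rmaj p a (ins k m w))) ≈ pow R q (rmaj p a w) ⊛ qint R q (suc (length w))
  rmaj-insertion {m} p a [] p< a< [] rewrite ⊔-<ᵇ m p a (<⇒≤ p<) (<⇒≤ a<) = R.sym (R.*-identityˡ _)
  rmaj-insertion {m} p a (b ∷ w) p< a< (b< ∷ w<) = begin
    Σ[ upTo (2 + l) ] (λ k → pow R q (rmaj p a (ins k m (b ∷ w))))
      ≈⟨ Σ-upTo-∷ʳ (suc l) _ ⟩
    Σ[ upTo (suc l) ] (λ k → pow R q (rmaj p a (ins k m (b ∷ w)))) ⊕ pow R q (rmaj p a (ins (suc l) m (b ∷ w)))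
      ≈⟨ R.+-cong (Σ-cong (upTo (suc l)) (λ k∈ → later (≤-pred (∈-upTo⁻ k∈)))) (pow-≡ q before) ⟩
    Σ[ upTo (suc l) ] (λ k → pow R q (desc (2 + l)) ⊛ pow R q (rmaj (p ⊓ a) b (ins k m w))) ⊕ pow R q (suc l + ρ)
      ≈⟨ R.+-cong (R.trans (Σ-*ˡ (upTo (suc l)) _ _)
           (R.*-congˡ (rmaj-insertion (p ⊓ a) b w (≤-<-trans (m⊓n≤m p a) p<) b< w<))) (pow-+ q (suc l) ρ) ⟩
    pow R q (desc (2 + l)) ⊛ (pow R q ρ ⊛ Q) ⊕ pow R q (suc l) ⊛ pow R q ρ
      ≈⟨ combine (b <ᵇ p ⊔ a) ⟩
    pow R q (desc (suc l) + ρ) ⊛ qint R q (2 + l) ∎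
    where
    l = length w
    ρ = rmaj (p ⊓ a) b w
    Q = qint R q (suc l)
    desc : ℕ → ℕ
    desc n = if b <ᵇ p ⊔ a then n else 0
    later : ∀ {k} → k ≤ l → pow R q (rmaj p a (ins k m (b ∷ w))) ≈ pow R q (desc (2 + l)) ⊛ pow R q (rmaj (p ⊓ a) b (ins k m w))
    later {k} k≤ = R.trans (pow-≡ q (trans (cong (rmaj p a) (ins-∷ m b w k≤))
      (cong (λ n → desc (suc n) + rmaj (p ⊓ a) b (ins k m w)) (↭-length (ins-↭ k m w))))) (pow-+ q (desc (2 + l)) _)
    -- m exceeds both `p` and `a` and is no descent itself; b now follows m and always is one, of
    -- weight `suc l`. The minimum passed on to w is still `p ⊓ a`.
    before : rmaj p a (ins (suc l) m (b ∷ w)) ≡ suc l + ρ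
    before rewrite n∸n≡0 l | ⊔-<ᵇ m p a (<⇒≤ p<) (<⇒≤ a<) | <ᵇ-true (≤-trans b< (m≤n⊔m (p ⊓ a) m))
                 | m≤n⇒m⊓n≡m (≤-trans (m⊓n≤m p a) (<⇒≤ p<)) = refl
    combine : ∀ d → pow R q (if d then 2 + l else 0) ⊛ (pow R q ρ ⊛ Q) ⊕ pow R q (suc l) ⊛ pow R q ρ
              ≈ pow R q ((if d then suc l else 0) + ρ) ⊛ qint R q (2 + l)
    combine true = begin
      q ⊛ x ⊛ (y ⊛ Q) ⊕ x ⊛ y
        ≈⟨ solve 4 (λ q x y Q → q :* x :* (y :* Q) :+ x :* y := x :* y :* (con 1 :+ q :* Q)) R.refl q x y Q ⟩
      x ⊛ y ⊛ (1# ⊕ q ⊛ Q)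
        ≈⟨ R.*-cong (pow-+ q (suc l) ρ) (qint-∷ (suc l)) ⟨
      pow R q (suc l + ρ) ⊛ qint R q (2 + l) ∎
      where
      x = pow R q (suc l)
      y = pow R q ρ
    combine false = begin
      1# ⊛ (y ⊛ Q) ⊕ x ⊛ y
        ≈⟨ R.+-cong (R.*-identityˡ _) (R.*-comm x y) ⟩
      y ⊛ Q ⊕ y ⊛ x      ≈⟨ R.distribˡ y Q x ⟨
      y ⊛ (Q ⊕ x)        ≈⟨ R.*-congˡ (Σ-upTo-∷ʳ (suc l) (pow R q)) ⟨
      y ⊛ qint R q (2 + l) ∎
      where
      x = pow R q (suc l)
      y = pow R q ρ

  -- Weighted sums along the factorisation

  weight : ℕ → ℕ → Carrier
  weight a d = pow R q a ⊛ pow R t d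

  weight-≡ : ∀ {a a′ d d′} → a ≡ a′ → d ≡ d′ → weight a d ≈ weight a′ d′
  weight-≡ refl refl = R.refl

  weight-≡ʳ : ∀ a {d d′} → d ≡ d′ → weight a d ≈ weight a d′
  weight-≡ʳ a refl = R.refl

  weight-top : ∀ r a d → weight (suc r + a) (suc d) ≈ weight a d ⊛ (pow R q (suc r) ⊛ t)
  weight-top r a d = begin
    pow R q (suc r + a) ⊛ (t ⊛ pow R t d)  ≈⟨ R.*-congʳ (pow-+ q (suc r) a) ⟩
    pow R q (suc r) ⊛ pow R q a ⊛ (t ⊛ pow R t d)
      ≈⟨ solve 4 (λ x y t z → x :* y :* (t :* z) := y :* z :* (x :* t)) R.refl (pow R q (suc r)) (pow R q a) t (pow R t d) ⟩
    weight a d ⊛ (pow R q (suc r) ⊛ t) ∎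

  weight-Σ : ∀ (f : ℕ → ℕ) {g : ℕ → ℕ} n a d → Σ[ upTo n ] (λ k → pow R q (f k)) ≈ pow R q a ⊛ qint R q n →
             (∀ {k} → k < n → g k ≡ d) → Σ[ upTo n ] (λ k → weight (f k) (g k)) ≈ weight a d ⊛ qint R q n
  weight-Σ f {g} n a d hf hg = begin
    Σ[ upTo n ] (λ k → weight (f k) (g k))
      ≈⟨ Σ-cong (upTo n) (λ {k} k∈ → weight-≡ʳ (f k) (hg (∈-upTo⁻ k∈))) ⟩
    Σ[ upTo n ] (λ k → pow R q (f k) ⊛ pow R t d)    ≈⟨ Σ-*ʳ (upTo n) (pow R t d) _ ⟩
    Σ[ upTo n ] (λ k → pow R q (f k)) ⊛ pow R t d    ≈⟨ R.*-congʳ hf ⟩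
    pow R q a ⊛ qint R q n ⊛ pow R t d
      ≈⟨ solve 3 (λ x y z → x :* y :* z := x :* z :* y) R.refl (pow R q a) (qint R q n) (pow R t d) ⟩
    weight a d ⊛ qint R q n                          ∎

  -- The induction step of the product formulas: `F` is the same for every `ks`, so it splits off as
  -- the last factor.
  Σ-tuples-suc : ∀ b r {f g} F → (∀ {ks} → Tuple b r ks → Σ[ upTo (b (suc r)) ] (λ k → g (ks ∷ʳ k)) ≈ f ks ⊛ F) →
                 Σ[ tuples b (suc r) ] g ≈ Σ[ tuples b r ] f ⊛ F
  Σ-tuples-suc b r {f} {g} F h = begin
    Σ[ tuples b (suc r) ] g
      ≈⟨ Σ-concatMap _ (tuples b r) g ⟩
    Σ[ tuples b r ] (λ ks → Σ[ map (ks ∷ʳ_) (upTo (b (suc r))) ] g)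
      ≈⟨ Σ-cong (tuples b r) (λ {ks} ks∈ → R.trans (R.reflexive (Σ-map (ks ∷ʳ_) (upTo (b (suc r))) g)) (h (∈-tuples⁻ r ks∈))) ⟩
    Σ[ tuples b r ] (λ ks → f ks ⊛ F)
      ≈⟨ Σ-*ʳ (tuples b r) F f ⟩
    Σ[ tuples b r ] f ⊛ F ∎

  -- What a statistic has to supply. Below the top exponent only the sum over k is prescribed, not
  -- the single terms: length increments appear in increasing order, those of rmaj in an order
  -- depending on u. The top exponent is kept apart because it alone contributes a factor t.
  module _ (stat : ℕ → List ℕ → ℕ)
    (stat-base : stat 1 (1 ∷ []) ≡ 0)
    (stat-Σ : ∀ {r u} → u ↭ range (suc r) →
      Σ[ upTo (suc r) ] (λ k → pow R q (stat (2 + r) (ins k (2 + r) u))) ≈ pow R q (stat (suc r) u) ⊛ qint R q (suc r))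
    (stat-top : ∀ {r u} → u ↭ range (suc r) → stat (2 + r) (2 + r ∷ u) ≡ suc r + stat (suc r) u)
    where

    Σ-tuplesS : ∀ r → Σ[ tuples suc r ] (λ ks → weight (stat (suc r) (permS (suc r) ks)) (delCountS ks)) ≈ prodS R (suc r) q t
    Σ-tuplesS zero = R.trans (R.+-identityʳ _) (R.trans (R.*-identityʳ _) (pow-≡ q stat-base))
    Σ-tuplesS (suc r) = R.trans (Σ-tuples-suc suc r (qint R q (suc r) ⊕ pow R q (suc r) ⊛ t) step) (R.*-congʳ (Σ-tuplesS r))
      where
      step : ∀ {ks} → Tuple suc r ks →
        Σ[ upTo (2 + r) ] (λ k → weight (stat (2 + r) (permS (2 + r) (ks ∷ʳ k))) (delCountS (ks ∷ʳ k)))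
        ≈ weight (stat (suc r) (permS (suc r) ks)) (delCountS ks) ⊛ (qint R q (suc r) ⊕ pow R q (suc r) ⊛ t)
      step {ks} τ = begin
        Σ[ upTo (2 + r) ] (λ k → weight (stat (2 + r) (permS (2 + r) (ks ∷ʳ k))) (delCountS (ks ∷ʳ k)))
          ≈⟨ Σ-upTo-∷ʳ (suc r) _ ⟩
        Σ[ upTo (suc r) ] (λ k → weight (stat (2 + r) (permS (2 + r) (ks ∷ʳ k))) (delCountS (ks ∷ʳ k)))
          ⊕ weight (stat (2 + r) (permS (2 + r) (ks ∷ʳ suc r))) (delCountS (ks ∷ʳ suc r))
          ≈⟨ R.+-cong
               (weight-Σ (λ k → stat (2 + r) (permS (2 + r) (ks ∷ʳ k))) (suc r) (stat (suc r) u) (delCountS ks)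
                 (R.trans (Σ-cong (upTo (suc r)) (λ k∈ → pow-≡ q (cong (stat (2 + r)) (permS-∷ʳ τ (<⇒≤ (∈-upTo⁻ k∈)))))) (stat-Σ u↭))
                 (λ {k} k< → trans (delCountS-∷ʳ k τ) (cong (λ b → bit b + delCountS ks) (≡ᵇ-false (<⇒≢ k<)))))
               (R.trans (weight-≡ top (trans (delCountS-∷ʳ (suc r) τ) (cong (λ b → bit b + delCountS ks) (≡ᵇ-refl (suc r)))))
                 (weight-top r (stat (suc r) u) (delCountS ks))) ⟩
        W ⊛ qint R q (suc r) ⊕ W ⊛ (pow R q (suc r) ⊛ t)
          ≈⟨ R.distribˡ W _ _ ⟨
        W ⊛ (qint R q (suc r) ⊕ pow R q (suc r) ⊛ t) ∎
        where
        u = permS (suc r) ks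
        W = weight (stat (suc r) u) (delCountS ks)
        u↭ : u ↭ range (suc r)
        u↭ = proj₁ (S.perm-valid τ)
        top : stat (2 + r) (permS (2 + r) (ks ∷ʳ suc r)) ≡ suc r + stat (suc r) u
        top = trans (cong (stat (2 + r)) (trans (permS-∷ʳ τ ≤-refl)
          (trans (cong (λ l → ins l (2 + r) u) (sym (trans (↭-length u↭) (length-range (suc r))))) (ins-length (2 + r) u))))
          (stat-top u↭)

    Σ-Sym : ∀ r → Σ[ Sym (suc r) ] (λ σ → weight (stat (suc r) σ) (delS (suc r) σ)) ≈ prodS R (suc r) q t
    Σ-Sym r = begin
      Σ[ Sym (suc r) ] f                              ≈⟨ Σ-↭ f (Sym-↭ r) ⟩
      Σ[ map (permS (suc r)) (tuples suc r) ] f       ≡⟨ Σ-map (permS (suc r)) (tuples suc r) f ⟩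
      Σ[ tuples suc r ] (f ∘ permS (suc r))
        ≈⟨ Σ-cong (tuples suc r) (λ {ks} ks∈ → weight-≡ʳ (stat (suc r) (permS (suc r) ks)) (delS-permS (∈-tuples⁻ r ks∈))) ⟩
      Σ[ tuples suc r ] (λ ks → weight (stat (suc r) (permS (suc r) ks)) (delCountS ks))  ≈⟨ Σ-tuplesS r ⟩
      prodS R (suc r) q t ∎
      where
      f : List ℕ → Carrier
      f σ = weight (stat (suc r) σ) (delS (suc r) σ)

  -- Here two exponents are at the top, for a_j ⋯ a_2 a_1 and a_j ⋯ a_2 a_1⁻¹. They share one
  -- increment and one power of t, whence the coefficient 2 in the product.
  module _ (stat : ℕ → List ℕ → ℕ)
    (stat-base : stat 1 (1 ∷ 2 ∷ []) ≡ 0)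
    (stat-Σ : ∀ {r u} → ValidA r u →
      Σ[ upTo (suc r) ] (λ k → pow R q (stat (2 + r) (ins k (3 + r) (swap^ k u)))) ≈ pow R q (stat (suc r) u) ⊛ qint R q (suc r))
    (stat-top : ∀ {r k u} → ValidA r u → suc r ≤ k → k ≤ 2 + r →
      stat (2 + r) (ins k (3 + r) (swap^ k u)) ≡ suc r + stat (suc r) u)
    where

    Σ-tuplesA : ∀ r → Σ[ tuples (suc ∘ suc) r ] (λ ks → weight (stat (suc r) (permA (suc r) ks)) (delCountA ks)) ≈ prodA R (suc r) q t
    Σ-tuplesA zero = R.trans (R.+-identityʳ _) (R.trans (R.*-identityʳ _) (pow-≡ q stat-base))
    Σ-tuplesA (suc r) = R.trans
      (Σ-tuples-suc (suc ∘ suc) r (qint R q (suc r) ⊕ (1# ⊕ 1#) ⊛ (pow R q (suc r) ⊛ t)) step)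
      (R.*-congʳ (Σ-tuplesA r))
      where
      step : ∀ {ks} → Tuple (suc ∘ suc) r ks →
        Σ[ upTo (3 + r) ] (λ k → weight (stat (2 + r) (permA (2 + r) (ks ∷ʳ k))) (delCountA (ks ∷ʳ k)))
        ≈ weight (stat (suc r) (permA (suc r) ks)) (delCountA ks) ⊛ (qint R q (suc r) ⊕ (1# ⊕ 1#) ⊛ (pow R q (suc r) ⊛ t))
      step {ks} τ = begin
        Σ[ upTo (3 + r) ] w
          ≈⟨ R.trans (Σ-upTo-∷ʳ (2 + r) w) (R.+-congʳ (Σ-upTo-∷ʳ (suc r) w)) ⟩
        Σ[ upTo (suc r) ] w ⊕ w (suc r) ⊕ w (2 + r)
          ≈⟨ R.+-cong (R.+-cong
               (weight-Σ (λ k → stat (2 + r) (permA (2 + r) (ks ∷ʳ k))) (suc r) (stat (suc r) u) (delCountA ks)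
                 (R.trans (Σ-cong (upTo (suc r)) (λ k∈ →
                     pow-≡ q (cong (stat (2 + r)) (permA-∷ʳ τ (<⇒≤ (<-trans (∈-upTo⁻ k∈) (n<1+n _))))))) (stat-Σ valid))
                 (λ {k} k< → trans (delCountA-∷ʳ k τ) (cong (_+ delCountA ks) (count-factorA-short k<))))
               (top (suc r) ≤-refl (n≤1+n (suc r)) (count-factorA-pos r)))
               (top (2 + r) (n≤1+n (suc r)) ≤-refl (count-factorA-neg r)) ⟩
        W ⊛ qint R q (suc r) ⊕ W ⊛ x ⊕ W ⊛ x
          ≈⟨ solve 3 (λ W Q x → W :* Q :+ W :* x :+ W :* x := W :* (Q :+ (con 1 :+ con 1) :* x)) R.refl W (qint R q (suc r)) x ⟩
        W ⊛ (qint R q (suc r) ⊕ (1# ⊕ 1#) ⊛ x) ∎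
        where
        u = permA (suc r) ks
        W = weight (stat (suc r) u) (delCountA ks)
        x = pow R q (suc r) ⊛ t
        w : ℕ → Carrier
        w k = weight (stat (2 + r) (permA (2 + r) (ks ∷ʳ k))) (delCountA (ks ∷ʳ k))
        valid : ValidA r u
        valid = A.perm-valid τ
        top : ∀ k → suc r ≤ k → k ≤ 2 + r → count (λ l → index l ≡ᵇ 1) (factorA (suc r) k) ≡ 1 → w k ≈ W ⊛ x
        top k 1+r≤k k≤ one = R.trans
          (weight-≡ (trans (cong (stat (2 + r)) (permA-∷ʳ τ k≤)) (stat-top valid 1+r≤k k≤))
                    (trans (delCountA-∷ʳ k τ) (cong (_+ delCountA ks) one)))
          (weight-top r (stat (suc r) u) (delCountA ks))

    Σ-Alt : ∀ r → Σ[ Alt (suc r) ] (λ σ → weight (stat (suc r) σ) (delA (suc r) σ)) ≈ prodA R (suc r) q t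
    Σ-Alt r = begin
      Σ[ Alt (suc r) ] f                                      ≈⟨ Σ-↭ f (Alt-↭ r) ⟩
      Σ[ map (permA (suc r)) (tuples (suc ∘ suc) r) ] f       ≡⟨ Σ-map (permA (suc r)) (tuples (suc ∘ suc) r) f ⟩
      Σ[ tuples (suc ∘ suc) r ] (f ∘ permA (suc r))
        ≈⟨ Σ-cong (tuples (suc ∘ suc) r) (λ {ks} ks∈ → weight-≡ʳ (stat (suc r) (permA (suc r) ks))
             (cong (count (λ l → index l ≡ᵇ 1)) (factWordA-permA (∈-tuples⁻ r ks∈)))) ⟩
      Σ[ tuples (suc ∘ suc) r ] (λ ks → weight (stat (suc r) (permA (suc r) ks)) (delCountA ks))  ≈⟨ Σ-tuplesA r ⟩
      prodA R (suc r) q t ∎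
      where
      f : List ℕ → Carrier
      f σ = weight (stat (suc r) σ) (delA (suc r) σ)

  -- The four distributions

  private
    length≡ : ∀ {n u} → u ↭ range n → length u ≡ n
    length≡ {n} u↭ = trans (↭-length u↭) (length-range n)

  Σ-ℓS : ∀ r → Σ[ Sym (suc r) ] (λ σ → weight (ℓS σ) (delS (suc r) σ)) ≈ prodS R (suc r) q t
  Σ-ℓS = Σ-Sym (λ _ → ℓS) refl
    (λ {r} {u} u↭ → Σ-pow-+ (suc r) (ℓS u) (λ k< → ℓS-ins (subst (_ ≤_) (sym (length≡ u↭)) (<⇒≤ k<)) (all-< u↭)))
    (λ {r} {u} u↭ → trans (ℓS-insAt 0 (all-< u↭)) (cong (_+ ℓS u) (length≡ u↭)))

  Σ-rmajS : ∀ r → Σ[ Sym (suc r) ] (λ σ → weight (rmajS (suc r) σ) (delS (suc r) σ)) ≈ prodS R (suc r) q t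
  Σ-rmajS = Σ-Sym rmajS refl insertion top
    where
    insertion : ∀ {r u} → u ↭ range (suc r) →
      Σ[ upTo (suc r) ] (λ k → pow R q (rmajS (2 + r) (ins k (2 + r) u))) ≈ pow R q (rmajS (suc r) u) ⊛ qint R q (suc r)
    insertion {u = []} u↭ with length≡ u↭
    ... | ()
    insertion {r} {a ∷ w} u↭ with length≡ u↭ | all-< u↭
    ... | refl | a< ∷ w< = begin
      Σ[ upTo (suc r) ] (λ k → pow R q (rmajS (2 + r) (ins k (2 + r) (a ∷ w))))
        ≈⟨ Σ-cong (upTo (suc r)) (λ k∈ → pow-≡ q (rmajS-ins (≤-pred (∈-upTo⁻ k∈)))) ⟩
      Σ[ upTo (suc r) ] (λ k → pow R q (rmaj 0 a (ins k (2 + r) w)))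
        ≈⟨ rmaj-insertion 0 a w (s≤s z≤n) a< w< ⟩
      pow R q (rmaj 0 a w) ⊛ qint R q (suc r)
        ≈⟨ R.*-congʳ (pow-≡ q (rmajS-rmaj a w)) ⟨
      pow R q (rmajS (suc r) (a ∷ w)) ⊛ qint R q (suc r) ∎
      where
      rmajS-ins : ∀ {k} → k ≤ length w → rmajS (2 + r) (ins k (2 + r) (a ∷ w)) ≡ rmaj 0 a (ins k (2 + r) w)
      rmajS-ins {k} k≤ = trans
        (cong₂ rmajS (cong suc (sym (↭-length (ins-↭ k (2 + r) w)))) (ins-∷ (2 + r) a w k≤))
        (rmajS-rmaj a (ins k (2 + r) w))
    top : ∀ {r u} → u ↭ range (suc r) → rmajS (2 + r) (2 + r ∷ u) ≡ suc r + rmajS (suc r) u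
    top {u = []} u↭ with length≡ u↭
    ... | ()
    top {r} {a ∷ w} u↭ with length≡ u↭ | all-< u↭
    ... | refl | a< ∷ _ = trans (rmajS-rmaj (2 + r) (a ∷ w))
      (trans (cong (λ b → (if b then suc r else 0) + rmaj 0 a w) (<ᵇ-true a<)) (cong (suc r +_) (sym (rmajS-rmaj a w))))

  Σ-ℓA : ∀ r → Σ[ Alt (suc r) ] (λ σ → weight (ℓA (suc r) σ) (delA (suc r) σ)) ≈ prodA R (suc r) q t
  Σ-ℓA = Σ-Alt ℓA refl
    (λ {r} {u} v → Σ-pow-+ (suc r) (ℓA (suc r) u) (λ {k} k< →
      trans (ℓA-ins v (<⇒≤ (<-trans k< (n<1+n _)))) (cong (_+ ℓA (suc r) u) (length-factorA-short (<⇒≤ k<)))))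
    top
    where
    top : ∀ {r k u} → ValidA r u → suc r ≤ k → k ≤ 2 + r →
          ℓA (2 + r) (ins k (3 + r) (swap^ k u)) ≡ suc r + ℓA (suc r) u
    top {r} {k} {u} v 1+r≤k k≤ = trans (ℓA-ins v k≤) (cong (_+ ℓA (suc r) u) len)
      where
      len : length (factorA (suc r) k) ≡ suc r
      len with m≤n⇒m<n∨m≡n k≤
      ... | inj₂ refl = length-factorA-long r
      ... | inj₁ k<   = trans (length-factorA-short (≤-pred k<)) (≤-antisym (≤-pred k<) 1+r≤k)

  Σ-rmajA : ∀ r → Σ[ Alt (suc r) ] (λ σ → weight (rmajA (suc r) σ) (delA (suc r) σ)) ≈ prodA R (suc r) q t
  Σ-rmajA = Σ-Alt rmajA refl insertion rmajA-ins-top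
    where
    insertion : ∀ {r u} → ValidA r u →
      Σ[ upTo (suc r) ] (λ k → pow R q (rmajA (2 + r) (ins k (3 + r) (swap^ k u)))) ≈ pow R q (rmajA (suc r) u) ⊛ qint R q (suc r)
    insertion {u = []} (u↭ , _) with length≡ u↭
    ... | ()
    insertion {u = x ∷ []} (u↭ , _) with length≡ u↭
    ... | ()
    insertion {r} {x ∷ y ∷ w} v@(u↭ , _) with length≡ u↭ | all-< u↭
    ... | refl | x< ∷ y< ∷ w< = begin
      Σ[ upTo (suc r) ] (λ k → pow R q (rmajA (2 + r) (ins k (3 + r) (swap^ k (x ∷ y ∷ w)))))
        ≈⟨ Σ-cong (upTo (suc r)) (λ k∈ → pow-≡ q (rmajA-ins (≤-pred (∈-upTo⁻ k∈)))) ⟩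
      Σ[ upTo (suc r) ] (λ k → pow R q (rmaj y x (ins k (3 + r) w)))
        ≈⟨ rmaj-insertion y x w y< x< w< ⟩
      pow R q (rmaj y x w) ⊛ qint R q (suc r)
        ≈⟨ R.*-congʳ (pow-≡ q (rmajA≡rmajWord v)) ⟨
      pow R q (rmajA (suc r) (x ∷ y ∷ w)) ⊛ qint R q (suc r) ∎
      where
      -- For k at most `length w` the new letter stays behind x and y, so the twist has no effect
      -- and x, y become the two parameters of `rmaj`.
      rmajA-ins : ∀ {k} → k ≤ length w → rmajA (2 + r) (ins k (3 + r) (swap^ k (x ∷ y ∷ w))) ≡ rmaj y x (ins k (3 + r) w)
      rmajA-ins {k} k≤ = trans (rmajA≡rmajWord (ins-validA v (m≤n⇒m≤1+n (m≤n⇒m≤1+n k≤))))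
        (trans (rmajWord-ins-swap^ k (3 + r) (x ∷ y ∷ w) (s≤s (s≤s k≤)))
          (cong rmajWord (trans (ins-∷ (3 + r) x (y ∷ w) (m≤n⇒m≤1+n k≤)) (cong (x ∷_) (ins-∷ (3 + r) y w k≤)))))

theorem6p1 : ∀ {c ℓ} (R : CommutativeSemiring c ℓ) (n : ℕ) → 1 ≤ n →
    (q t : CommutativeSemiring.Carrier R) →
    let open CommutativeSemiring R in
    ((sumOver R (Sym n) (λ σ → pow R q (ℓS σ) * pow R t (delS n σ))
    ≈ sumOver R (Sym n) (λ σ → pow R q (rmajS n σ) * pow R t (delS n σ)))
    × (sumOver R (Sym n) (λ σ → pow R q (rmajS n σ) * pow R t (delS n σ))
    ≈ prodS R n q t))
    ×
    ((sumOver R (Alt n) (λ w → pow R q (ℓA n w) * pow R t (delA n w))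
    ≈ sumOver R (Alt n) (λ w → pow R q (rmajA n w) * pow R t (delA n w)))
    × (sumOver R (Alt n) (λ w → pow R q (rmajA n w) * pow R t (delA n w))
    ≈ prodA R n q t))
theorem6p1 R (suc r) _ q t =
  (R.trans (Σ-ℓS r) (R.sym (Σ-rmajS r)) , Σ-rmajS r) , (R.trans (Σ-ℓA r) (R.sym (Σ-rmajA r)) , Σ-rmajA r)
  where
  module R = CommutativeSemiring R
  open GeneratingFunctions R q t
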